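{- Satisfiability for $\mathrm{LDDL}$ is undecidable: there is no algorithm that decides, given an $\mathrm{LDDL}$ formula $\phi$, whether there exists a (finite) pointed graph $G^u$ with $G^u\models\phi$.
   Context: Fix a finite set $\Pi=\{p_1,\dots,p_n\}$ of propositions (node labels). A graph is $G=(V,E,\mathrm{lab})$ with $V$ finite, $E\subseteq V\times V$ irreflexive and symmetric, $\mathrm{lab}:V\to\{0,1\}^n$; a pointed graph $G^u$ has a distinguished node $u$. $\mathrm{LDDL}$: formulas $\phi::=p\mid\top\mid\phi_1\wedge\phi_2\mid\neg\phi\mid\langle\pi\rangle\phi\mid[\pi]\phi\mid\langle\pi\rangle^{=1}\phi$ ($p\in\Pi$), programs $\pi::=\mathrm{step}\mid\mathrm{test}(\phi)\mid\pi_1;\pi_2\mid\pi_1\cup\pi_2$. In a graph $G$: $[\![p_i]\!]=\{u\mid\mathrm{lab}(u)_i=1\}$, $[\![\top]\!]=V$, $\wedge,\neg$ as intersection/complement; $[\![\langle\pi\rangle\phi]\!]=\{u\mid\exists v\in[\![\phi]\!],(u,v)\in[\![\pi]\!]\}$; $[\![[\pi]\phi]\!]=\{u\mid\forall v,(u,v)\in[\![\pi]\!]\Rightarrow v\in[\![\phi]\!]\}$; $[\![\langle\pi\rangle^{=1}\phi]\!]=\{u\mid$ there is exactly one $v\in[\![\phi]\!]$ with $(u,v)\in[\![\pi]\!]\}$; $[\![\mathrm{step}]\!]=E$, $[\![\mathrm{test}(\phi)]\!]=\{(u,u)\mid u\in[\![\phi]\!]\}$, $[\![\pi_1;\pi_2]\!]$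 is relational composition (first $\pi_1$ then $\pi_2$), $[\![\pi_1\cup\pi_2]\!]$ is union. $G^u\models\phi$ iff $u\in[\![\phi]\!]$. The set $\Pi$ may be chosen depending on the formula (the formula's propositions). -}

module Defs where

open import Data.Nat using (ℕ; zero; suc; _+_; _*_; _∸_; _^_; _<_; _≡ᵇ_)
open import Data.Fin using (Fin; toℕ)
open import Data.Fin as F using ()
open import Data.Bool using (Bool; true; false; _∧_; _∨_; not; if_then_else_)
open import Data.Vec using (Vec; []; _∷_; lookup)
open import Data.Product using (Σ; _×_; ∃)
open import Relation.Binary.PropositionalEquality using (_≡_)
open import Relation.Nullary using (¬_)

-- LDDL syntax.  Propositions are p i for i : ℕ (the finite set Π of a
-- formula is the set of indices occurring in it).

mutual
  data Form : Set where
    prop  : ℕ → Form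
    ⊤f    : Form
    _∧f_  : Form → Form → Form
    ¬f_   : Form → Form
    ⟨_⟩_  : Prog → Form → Form
    [_]_  : Prog → Form → Form
    ⟨_⟩⁼¹_ : Prog → Form → Form

  data Prog : Set where
    step : Prog
    test : Form → Prog
    _⨾_  : Prog → Prog → Prog
    _∪p_ : Prog → Prog → Prog

record Graph (k : ℕ) : Set where
  field
    E     : Fin k → Fin k → Bool
    irrefl : ∀ u → E u u ≡ false
    symm   : ∀ u v → E u v ≡ E v u
    lab   : Fin k → ℕ → Bool

anyFin : ∀ {k} → (Fin k → Bool) → Bool
anyFin {zero}  f = false
anyFin {suc k} f = f F.zero ∨ anyFin (λ i → f (F.suc i))

allFin : ∀ {k} → (Fin k → Bool) → Bool
allFin {zero}  f = true
allFin {suc k} f = f F.zero ∧ allFin (λ i → f (F.suc i))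

countFin : ∀ {k} → (Fin k → Bool) → ℕ
countFin {zero}  f = zero
countFin {suc k} f = (if f F.zero then 1 else 0) + countFin (λ i → f (F.suc i))

eqFin : ∀ {k} → Fin k → Fin k → Bool
eqFin u v = toℕ u ≡ᵇ toℕ v

module Sem {k : ℕ} (G : Graph k) where
  open Graph G
  mutual
    ⟦_⟧ : Form → Fin k → Bool
    ⟦ prop i ⟧ u = lab u i
    ⟦ ⊤f ⟧ u = true
    ⟦ φ ∧f ψ ⟧ u = ⟦ φ ⟧ u ∧ ⟦ ψ ⟧ u
    ⟦ ¬f φ ⟧ u = not (⟦ φ ⟧ u)
    ⟦ ⟨ π ⟩ φ ⟧ u = anyFin (λ v → ⟦ π ⟧ₚ u v ∧ ⟦ φ ⟧ v)
    ⟦ [ π ] φ ⟧ u = allFin (λ v → not (⟦ π ⟧ₚ u v) ∨ ⟦ φ ⟧ v)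
    ⟦ ⟨ π ⟩⁼¹ φ ⟧ u = countFin (λ v → ⟦ π ⟧ₚ u v ∧ ⟦ φ ⟧ v) ≡ᵇ 1

    ⟦_⟧ₚ : Prog → Fin k → Fin k → Bool
    ⟦ step ⟧ₚ u v = E u v
    ⟦ test φ ⟧ₚ u v = eqFin u v ∧ ⟦ φ ⟧ u
    ⟦ π₁ ⨾ π₂ ⟧ₚ u v = anyFin (λ w → ⟦ π₁ ⟧ₚ u w ∧ ⟦ π₂ ⟧ₚ w v)
    ⟦ π₁ ∪p π₂ ⟧ₚ u v = ⟦ π₁ ⟧ₚ u v ∨ ⟦ π₂ ⟧ₚ u v

_,_⊨_ : ∀ {k} → Graph k → Fin k → Form → Set
G , u ⊨ φ = Sem.⟦_⟧ G φ u ≡ true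

Satisfiable : Form → Set
Satisfiable φ = Σ ℕ λ k → Σ (Graph k) λ G → Σ (Fin k) λ u → G , u ⊨ φ

-- Gödel numbering of formulas (pairing ℕ×ℕ → ℕ, bijective)

pair : ℕ → ℕ → ℕ
pair a b = (2 ^ a) * (2 * b + 1) ∸ 1

mutual
  code : Form → ℕ
  code (prop i) = pair 0 i
  code ⊤f = pair 1 0
  code (φ ∧f ψ) = pair 2 (pair (code φ) (code ψ))
  code (¬f φ) = pair 3 (code φ)
  code (⟨ π ⟩ φ) = pair 4 (pair (codeP π) (code φ))
  code ([ π ] φ) = pair 5 (pair (codeP π) (code φ))
  code (⟨ π ⟩⁼¹ φ) = pair 6 (pair (codeP π) (code φ))

  codeP : Prog → ℕ
  codeP step = pair 0 0
  codeP (test φ) = pair 1 (code φ)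
  codeP (π₁ ⨾ π₂) = pair 2 (pair (codeP π₁) (codeP π₂))
  codeP (π₁ ∪p π₂) = pair 3 (pair (codeP π₁) (codeP π₂))

data PR : ℕ → Set where
  zeroF : ∀ {n} → PR n
  succF : PR 1
  proj  : ∀ {n} → Fin n → PR n
  comp  : ∀ {m n} → PR m → Vec (PR n) m → PR n
  prec  : ∀ {n} → PR n → PR (suc (suc n)) → PR (suc n)
  mu    : ∀ {n} → PR (suc n) → PR n

mutual
  data _⟦_⟧↓_ : ∀ {n} → PR n → Vec ℕ n → ℕ → Set where
    zero↓ : ∀ {n} {xs : Vec ℕ n} → zeroF ⟦ xs ⟧↓ 0
    succ↓ : ∀ {x} → succF ⟦ x ∷ [] ⟧↓ suc x
    proj↓ : ∀ {n} {i : Fin n} {xs} → proj i ⟦ xs ⟧↓ lookup xs i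
    comp↓ : ∀ {m n} {f : PR m} {gs : Vec (PR n) m} {xs ys y} →
            gs ⟦ xs ⟧↓* ys → f ⟦ ys ⟧↓ y → comp f gs ⟦ xs ⟧↓ y
    prec0↓ : ∀ {n} {g : PR n} {h} {xs y} →
             g ⟦ xs ⟧↓ y → prec g h ⟦ 0 ∷ xs ⟧↓ y
    precS↓ : ∀ {n} {g : PR n} {h} {x xs r y} →
             prec g h ⟦ x ∷ xs ⟧↓ r → h ⟦ x ∷ r ∷ xs ⟧↓ y →
             prec g h ⟦ suc x ∷ xs ⟧↓ y
    mu↓   : ∀ {n} {f : PR (suc n)} {xs y} →
            f ⟦ y ∷ xs ⟧↓ 0 →
            (∀ z → z < y → Σ ℕ λ r → f ⟦ z ∷ xs ⟧↓ suc r) →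
            mu f ⟦ xs ⟧↓ y

  data _⟦_⟧↓*_ : ∀ {m n} → Vec (PR n) m → Vec ℕ n → Vec ℕ m → Set where
    []↓  : ∀ {n} {xs : Vec ℕ n} → [] ⟦ xs ⟧↓* []
    _∷↓_ : ∀ {m n} {g : PR n} {gs : Vec (PR n) m} {xs y ys} →
           g ⟦ xs ⟧↓ y → gs ⟦ xs ⟧↓* ys → (g ∷ gs) ⟦ xs ⟧↓* (y ∷ ys)

DecidesSat : PR 1 → Set
DecidesSat d = ∀ φ → (Satisfiable φ → d ⟦ code φ ∷ [] ⟧↓ 1)
                   × (¬ Satisfiable φ → d ⟦ code φ ∷ [] ⟧↓ 0)

{-# OPTIONS --safe #-}

-- For a register machine M, a formula χ_M is written whose models are runs of M that never fail: a hub
-- adjacent to all elements makes "for all elements" expressible, directed relations are coded by labelled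
-- paths of length three, and ⟨π⟩⁼¹ forces a successor relation S to be injective and functional and
-- compares register contents by uniqueness of a common target.  The element n (the n-th S-successor of
-- the zero element) stands both for the number n and for the n-th instant of the run.  The input n is
-- supplied by a conjunct whose Gödel number is primitive recursive in n.
-- Given a decider d, let M on input n compute d on the Gödel number of "the formula coded by n, with
-- input n", halt if the result is 0 and fail otherwise.  With n the code of χ_M, the formula asked about
-- is satisfiable iff M halts rather than fails, iff d declares it unsatisfiable.

module Submission where

open import Defs
open import Relation.Nullary using (¬_)
open import Data.Product using (Σ)

open import Data.Bool using (Bool; true; false; T; _∧_; _∨_; not; if_then_else_)
open import Data.Bool.Properties using (∧-conicalˡ; ∧-conicalʳ; ¬-not; not-¬)
open import Data.Empty using (⊥-elim)
open import Data.Fin using (Fin; toℕ; fromℕ<)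
import Data.Fin as F
open import Data.Fin.Properties as F using (toℕ-injective; toℕ-fromℕ<; toℕ<n; +↔⊎; *↔×; 1↔⊤)
open import Data.List using (List; []; _∷_; _++_; length)
open import Data.List.Properties using (length-++; ++-assoc)
open import Data.Nat using (ℕ; zero; suc; _+_; _*_; _∸_; _^_; _<_; _≤_; _⊔_; _≡ᵇ_; z≤n; s≤s; _≟_; _<?_)
open import Data.Nat.Properties
open import Data.Product using (_×_; _,_; proj₁; proj₂)
open import Data.Product.Function.NonDependent.Propositional using (_×-↔_)
open import Data.Sum using (_⊎_; inj₁; inj₂)
open import Data.Sum.Function.Propositional using (_⊎-↔_)
open import Data.Unit using (⊤; tt)
open import Data.Vec as V using (Vec; []; _∷_; lookup)
open import Data.Vec.Properties using (lookup-map)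
open import Data.Vec.Relation.Unary.All using (All; []; _∷_)
open import Function using (_↔_; Inverse)
open import Function.Properties.Inverse using (↔-refl; ↔-trans)
open import Relation.Nullary using (yes; no)
open import Relation.Nullary.Decidable using (⌊_⌋)
open import Relation.Binary.PropositionalEquality using (_≡_; _≢_; refl; sym; trans; cong; cong₂; subst; subst₂)

-- Relational semantics

-- Propositions replace Booleans and an arbitrary carrier replaces `Fin k`, so that a model can live
-- on a structured type of nodes and be analysed by pattern matching.
module Relational {X : Set} (edge : X → X → Bool) (label : X → ℕ → Bool) where

  Edge : X → X → Set
  Edge x y = edge x y ≡ true

  mutual
    Holds : Form → X → Set
    Holds (prop i)     x = label x i ≡ true
    Holds ⊤f           x = ⊤
    Holds (φ ∧f ψ)     x = Holds φ x × Holds ψ x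
    Holds (¬f φ)       x = ¬ Holds φ x
    Holds (⟨ π ⟩ φ)    x = Σ X λ y → Path π x y × Holds φ y
    Holds ([ π ] φ)    x = ∀ y → Path π x y → Holds φ y
    Holds (⟨ π ⟩⁼¹ φ)  x = Σ X λ y → (Path π x y × Holds φ y) × (∀ z → Path π x z → Holds φ z → z ≡ y)

    Path : Prog → X → X → Set
    Path step     x y = Edge x y
    Path (test φ) x y = x ≡ y × Holds φ x
    Path (π ⨾ ρ)  x y = Σ X λ z → Path π x z × Path ρ z y
    Path (π ∪p ρ) x y = Path π x y ⊎ Path ρ x y

-- Finite quantifiers, counting and Boolean connectives

anyFin⁺ : ∀ {k} (f : Fin k → Bool) v → f v ≡ true → anyFin f ≡ true
anyFin⁺ f F.zero p rewrite p = refl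
anyFin⁺ f (F.suc v) p with f F.zero
... | true  = refl
... | false = anyFin⁺ (λ i → f (F.suc i)) v p

anyFin⁻ : ∀ {k} (f : Fin k → Bool) → anyFin f ≡ true → Σ (Fin k) λ v → f v ≡ true
anyFin⁻ {suc k} f p with f F.zero in eq
... | true  = F.zero , eq
... | false = let v , q = anyFin⁻ (λ i → f (F.suc i)) p in F.suc v , q

allFin⁺ : ∀ {k} (f : Fin k → Bool) → (∀ v → f v ≡ true) → allFin f ≡ true
allFin⁺ {zero}  f p = refl
allFin⁺ {suc k} f p rewrite p F.zero = allFin⁺ (λ i → f (F.suc i)) (λ v → p (F.suc v))

allFin⁻ : ∀ {k} (f : Fin k → Bool) → allFin f ≡ true → ∀ v → f v ≡ true
allFin⁻ f p F.zero    = ∧-conicalˡ (f F.zero) _ p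
allFin⁻ f p (F.suc v) = allFin⁻ (λ i → f (F.suc i)) (∧-conicalʳ (f F.zero) _ p) v

Unique : ∀ {k} → (Fin k → Bool) → Set
Unique {k} f = Σ (Fin k) λ v → f v ≡ true × (∀ w → f w ≡ true → w ≡ v)

countFin-none : ∀ {k} (f : Fin k → Bool) → (∀ v → f v ≡ false) → countFin f ≡ 0
countFin-none {zero}  f p = refl
countFin-none {suc k} f p rewrite p F.zero = countFin-none (λ i → f (F.suc i)) (λ v → p (F.suc v))

countFin≡0⁻ : ∀ {k} (f : Fin k → Bool) → countFin f ≡ 0 → ∀ v → f v ≢ true
countFin≡0⁻ {suc k} f p v q with f F.zero in eq
countFin≡0⁻ {suc k} f () v         q | true
countFin≡0⁻ {suc k} f p  F.zero    q | false = not-¬ eq q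
countFin≡0⁻ {suc k} f p  (F.suc v) q | false = countFin≡0⁻ (λ i → f (F.suc i)) p v q

countFin≡1⁺ : ∀ {k} (f : Fin k → Bool) → Unique f → countFin f ≡ 1
countFin≡1⁺ f (F.zero , p , u) rewrite p =
  cong suc (countFin-none _ λ v → ¬-not λ q → F.0≢1+n (sym (u (F.suc v) q)))
countFin≡1⁺ f (F.suc v , p , u) with f F.zero in eq
... | false = countFin≡1⁺ (λ i → f (F.suc i)) (v , p , λ w q → F.suc-injective (u (F.suc w) q))
... | true with u F.zero eq
... | ()

countFin≡1⁻ : ∀ {k} (f : Fin k → Bool) → countFin f ≡ 1 → Unique f
countFin≡1⁻ {suc k} f p with f F.zero in eq
... | true = F.zero , eq , only
  where
  only : ∀ w → f w ≡ true → w ≡ F.zero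
  only F.zero    q = refl
  only (F.suc w) q = ⊥-elim (countFin≡0⁻ (λ i → f (F.suc i)) (suc-injective p) w q)
... | false with countFin≡1⁻ (λ i → f (F.suc i)) p
... | v , q , u = F.suc v , q , only
  where
  only : ∀ w → f w ≡ true → w ≡ F.suc v
  only F.zero    r = ⊥-elim (not-¬ eq r)
  only (F.suc w) r = cong F.suc (u w r)

≡ᵇ-true⁻ : ∀ m n → (m ≡ᵇ n) ≡ true → m ≡ n
≡ᵇ-true⁻ m n p = ≡ᵇ⇒≡ m n (subst T (sym p) tt)

≡ᵇ-true⁺ : ∀ {m n} → m ≡ n → (m ≡ᵇ n) ≡ true
≡ᵇ-true⁺ {zero}  refl = refl
≡ᵇ-true⁺ {suc m} refl = ≡ᵇ-true⁺ {m} refl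

∧-true : ∀ {a b} → a ≡ true → b ≡ true → a ∧ b ≡ true
∧-true refl refl = refl

∨-true : ∀ a {b} → a ∨ b ≡ true → a ≡ true ⊎ b ≡ true
∨-true true  p = inj₁ refl
∨-true false p = inj₂ p

⇒-true⁻ : ∀ {a b} → not a ∨ b ≡ true → a ≡ true → b ≡ true
⇒-true⁻ p refl = p

⇒-true⁺ : ∀ {a b} → (a ≡ true → b ≡ true) → not a ∨ b ≡ true
⇒-true⁺ {true}  f = f refl
⇒-true⁺ {false} f = refl

not-true⁻ : ∀ {a} → not a ≡ true → a ≢ true
not-true⁻ {false} _ ()

not-true⁺ : ∀ {a} → a ≢ true → not a ≡ true
not-true⁺ {false} _ = refl
not-true⁺ {true}  p = ⊥-elim (p refl)

-- The two semantics are compared along a bijection: the identity when a graph is given, an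
-- enumeration of the nodes when a model is built.
module Reflection {X : Set} (edge : X → X → Bool) (label : X → ℕ → Bool)
  {k : ℕ} (G : Graph k) (node : Fin k → X) (index : X → Fin k)
  (node-index : ∀ x → node (index x) ≡ x) (index-node : ∀ u → index (node u) ≡ u)
  (edge≡ : ∀ u v → Graph.E G u v ≡ edge (node u) (node v))
  (label≡ : ∀ u i → Graph.lab G u i ≡ label (node u) i) where

  open Relational edge label
  open Sem G

  onto : (P : X → Set) → (∀ v → P (node v)) → ∀ x → P x
  onto P p x = subst P (node-index x) (p (index x))

  node-injective : ∀ {u v} → node u ≡ node v → u ≡ v
  node-injective {u} {v} p = trans (sym (index-node u)) (trans (cong index p) (index-node v))

  mutual
    -- Both directions are proved together because negation and the path condition of a box exchange
    -- them.
    holds⁺ : ∀ φ u → ⟦ φ ⟧ u ≡ true → Holds φ (node u)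
    holds⁺ (prop i) u p = trans (sym (label≡ u i)) p
    holds⁺ ⊤f u p = tt
    holds⁺ (φ ∧f ψ) u p = holds⁺ φ u (∧-conicalˡ _ _ p) , holds⁺ ψ u (∧-conicalʳ (⟦ φ ⟧ u) _ p)
    holds⁺ (¬f φ) u p h = not-true⁻ p (holds⁻ φ u h)
    holds⁺ (⟨ π ⟩ φ) u p =
      let v , q = anyFin⁻ _ p in
      node v , path⁺ π u v (∧-conicalˡ _ _ q) , holds⁺ φ v (∧-conicalʳ (⟦ π ⟧ₚ u v) _ q)
    holds⁺ ([ π ] φ) u p = onto _ λ v q → holds⁺ φ v (⇒-true⁻ (allFin⁻ _ p v) (path⁻ π u v q))
    holds⁺ (⟨ π ⟩⁼¹ φ) u p =
      let v , q , unique = countFin≡1⁻ _ (≡ᵇ-true⁻ _ 1 p) in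
      node v ,
      (path⁺ π u v (∧-conicalˡ _ _ q) , holds⁺ φ v (∧-conicalʳ (⟦ π ⟧ₚ u v) _ q)) ,
      onto _ λ w r s → cong node (unique w (∧-true (path⁻ π u w r) (holds⁻ φ w s)))

    holds⁻ : ∀ φ u → Holds φ (node u) → ⟦ φ ⟧ u ≡ true
    holds⁻ (prop i) u h = trans (label≡ u i) h
    holds⁻ ⊤f u h = refl
    holds⁻ (φ ∧f ψ) u (h , h′) = ∧-true (holds⁻ φ u h) (holds⁻ ψ u h′)
    holds⁻ (¬f φ) u h = not-true⁺ λ p → h (holds⁺ φ u p)
    holds⁻ (⟨ π ⟩ φ) u (x , h) = onto (λ x → Path π (node u) x × Holds φ x → ⟦ ⟨ π ⟩ φ ⟧ u ≡ true)
      (λ v (q , h) → anyFin⁺ _ v (∧-true (path⁻ π u v q) (holds⁻ φ v h))) x h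
    holds⁻ ([ π ] φ) u h = allFin⁺ _ λ v → ⇒-true⁺ λ p → holds⁻ φ v (h (node v) (path⁺ π u v p))
    holds⁻ (⟨ π ⟩⁼¹ φ) u (x , h) = onto
      (λ x → (Path π (node u) x × Holds φ x) × (∀ z → Path π (node u) z → Holds φ z → z ≡ x) →
             ⟦ ⟨ π ⟩⁼¹ φ ⟧ u ≡ true)
      (λ v ((q , h) , unique) → ≡ᵇ-true⁺ (countFin≡1⁺ _
        (v , ∧-true (path⁻ π u v q) (holds⁻ φ v h) , λ w p → node-injective
          (unique (node w) (path⁺ π u w (∧-conicalˡ _ _ p)) (holds⁺ φ w (∧-conicalʳ (⟦ π ⟧ₚ u w) _ p))))))
      x h

    path⁺ : ∀ π u v → ⟦ π ⟧ₚ u v ≡ true → Path π (node u) (node v)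
    path⁺ step u v p = trans (sym (edge≡ u v)) p
    path⁺ (test φ) u v p =
      cong node (toℕ-injective (≡ᵇ-true⁻ _ _ (∧-conicalˡ _ _ p))) , holds⁺ φ u (∧-conicalʳ (eqFin u v) _ p)
    path⁺ (π ⨾ ρ) u v p =
      let w , q = anyFin⁻ _ p in
      node w , path⁺ π u w (∧-conicalˡ _ _ q) , path⁺ ρ w v (∧-conicalʳ (⟦ π ⟧ₚ u w) _ q)
    path⁺ (π ∪p ρ) u v p with ∨-true (⟦ π ⟧ₚ u v) p
    ... | inj₁ q = inj₁ (path⁺ π u v q)
    ... | inj₂ q = inj₂ (path⁺ ρ u v q)

    path⁻ : ∀ π u v → Path π (node u) (node v) → ⟦ π ⟧ₚ u v ≡ true
    path⁻ step u v q = trans (edge≡ u v) q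
    path⁻ (test φ) u v (q , h) = ∧-true (≡ᵇ-true⁺ (cong toℕ (node-injective q))) (holds⁻ φ u h)
    path⁻ (π ⨾ ρ) u v (x , q) = onto
      (λ x → Path π (node u) x × Path ρ x (node v) → ⟦ π ⨾ ρ ⟧ₚ u v ≡ true)
      (λ w (q , r) → anyFin⁺ _ w (∧-true (path⁻ π u w q) (path⁻ ρ w v r))) x q
    path⁻ (π ∪p ρ) u v (inj₁ q) rewrite path⁻ π u v q = refl
    path⁻ (π ∪p ρ) u v (inj₂ q) with ⟦ π ⟧ₚ u v
    ... | true  = refl
    ... | false = path⁻ ρ u v q

-- Register machines

data Expr : Set where
  zeroE    : Expr
  reg sucE : ℕ → Expr

data Instr : Set where
  _≔_       : ℕ → Expr → Instr
  jumpEq    : ℕ → ℕ → ℕ → Instr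
  halt fail : Instr

Store : Set
Store = ℕ → ℕ

Config : Set
Config = ℕ × Store

eval : Store → Expr → ℕ
eval σ zeroE    = 0
eval σ (reg r)  = σ r
eval σ (sucE r) = suc (σ r)

-- An instruction is read backwards: the expression, evaluated in the old store, gives the new
-- content of register `c`. One formula per register can then describe any instruction.
after : Instr → ℕ → Expr
after (r ≔ e) c = if ⌊ c ≟ r ⌋ then e else reg c
after _       c = reg c

target : Instr → ℕ → Store → ℕ
target (r ≔ e)        pc σ = suc pc
target (jumpEq r s a) pc σ = if ⌊ σ r ≟ σ s ⌋ then a else suc pc
-- `halt` and `fail` loop in place, so both are fixed points of `next`; only the fetched instruction
-- tells them apart.
target halt           pc σ = pc
target fail           pc σ = pc

execute : Instr → Config → Config
execute I (pc , σ) = target I pc σ , λ c → eval σ (after I c)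

fetch : List Instr → ℕ → Instr
-- Addresses beyond the program count as `halt`, on which the formula imposes nothing.
fetch []       _       = halt
fetch (I ∷ is) zero    = I
fetch (I ∷ is) (suc a) = fetch is a

next : List Instr → Config → Config
next prog c = execute (fetch prog (proj₁ c)) c

data _⊢_⟶*_ (prog : List Instr) : Config → Config → Set where
  done : ∀ {c} → prog ⊢ c ⟶* c
  more : ∀ {c c′} → prog ⊢ next prog c ⟶* c′ → prog ⊢ c ⟶* c′

⟶*-trans : ∀ {prog c c′ c″} → prog ⊢ c ⟶* c′ → prog ⊢ c′ ⟶* c″ → prog ⊢ c ⟶* c″
⟶*-trans done     q = q
⟶*-trans (more p) q = more (⟶*-trans p q)

perform : ∀ {prog I pc σ c} → fetch prog pc ≡ I → prog ⊢ execute I (pc , σ) ⟶* c → prog ⊢ (pc , σ) ⟶* c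
perform refl p = more p

after-same : ∀ σ r e → eval σ (after (r ≔ e) r) ≡ eval σ e
after-same σ r e with r ≟ r
... | yes _ = refl
... | no ¬p = ⊥-elim (¬p refl)

after-other : ∀ σ r e c → c ≢ r → eval σ (after (r ≔ e) c) ≡ σ c
after-other σ r e c c≢r with c ≟ r
... | yes p = ⊥-elim (c≢r p)
... | no _  = refl

target-eq : ∀ r s a pc σ → σ r ≡ σ s → target (jumpEq r s a) pc σ ≡ a
target-eq r s a pc σ p with σ r ≟ σ s
... | yes _ = refl
... | no ¬p = ⊥-elim (¬p p)

target-neq : ∀ r s a pc σ → σ r ≢ σ s → target (jumpEq r s a) pc σ ≡ suc pc
target-neq r s a pc σ ¬p with σ r ≟ σ s
... | yes p = ⊥-elim (¬p p)
... | no _  = refl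

jump : ∀ {prog r s a pc σ c} → fetch prog pc ≡ jumpEq r s a → σ r ≡ σ s →
       prog ⊢ (a , σ) ⟶* c → prog ⊢ (pc , σ) ⟶* c
jump {prog} {r} {s} {a} {pc} {σ} {c} eq p q =
  perform eq (subst (λ t → prog ⊢ (t , σ) ⟶* c) (sym (target-eq r s a pc σ p)) q)

fallThrough : ∀ {prog r s a pc σ c} → fetch prog pc ≡ jumpEq r s a → σ r ≢ σ s →
              prog ⊢ (suc pc , σ) ⟶* c → prog ⊢ (pc , σ) ⟶* c
fallThrough {prog} {r} {s} {a} {pc} {σ} {c} eq p q =
  perform eq (subst (λ t → prog ⊢ (t , σ) ⟶* c) (sym (target-neq r s a pc σ p)) q)

-- A block is position-dependent code: its argument is the address it is loaded at.
Block : Set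
Block = ℕ → List Instr

At : List Instr → ℕ → List Instr → Set
At prog b []       = ⊤
At prog b (I ∷ is) = fetch prog b ≡ I × At prog (suc b) is

At-++ : ∀ prog b is {js} → At prog b (is ++ js) → At prog b is × At prog (b + length is) js
At-++ prog b [] {js} p = tt , subst (λ a → At prog a js) (sym (+-identityʳ b)) p
At-++ prog b (I ∷ is) {js} (p , ps) =
  let q , r = At-++ prog (suc b) is ps in
  (p , q) , subst (λ a → At prog a js) (sym (+-suc b (length is))) r

fetch-tail : ∀ prog is b → fetch (prog ++ is) (length prog + b) ≡ fetch is b
fetch-tail []         is b = refl
fetch-tail (_ ∷ prog) is b = fetch-tail prog is b

-- The general prefix serves the induction, which moves the instructions into it one by one.
At-suffix : ∀ pre is → At (pre ++ is) (length pre) is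
At-suffix pre []       = tt
At-suffix pre (I ∷ is) =
  trans (cong (fetch (pre ++ I ∷ is)) (sym (+-identityʳ (length pre)))) (fetch-tail pre (I ∷ is) 0) ,
  subst₂ (λ prog a → At prog a is) (++-assoc pre (I ∷ []) is)
    (trans (length-++ pre) (+-comm (length pre) 1)) (At-suffix (pre ++ I ∷ []) is)

-- Total correctness in every context: wherever the block is loaded, control reaches the address
-- just after it. This is what makes blocks composable.
Computes : Block → Store → (Store → Set) → Set
Computes A σ Q = ∀ prog b → At prog b (A b) →
  Σ Store λ σ′ → prog ⊢ (b , σ) ⟶* (b + length (A b) , σ′) × Q σ′

skip : Block
skip b = []

assign : ℕ → Expr → Block
assign r e b = (r ≔ e) ∷ []

infixr 5 _⊕_

_⊕_ : Block → Block → Block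
(A ⊕ B) b = A b ++ B (b + length (A b))

-- The jump back to the loop head is the trivially true comparison of r with itself.
until : ℕ → ℕ → Block → Block
until r s A b = jumpEq r s (b + (2 + length (A (suc b)))) ∷ A (suc b) ++ jumpEq r r b ∷ []

computes-skip : ∀ {σ} {Q : Store → Set} → Q σ → Computes skip σ Q
computes-skip {σ} q prog b at = σ , subst (λ a → prog ⊢ (b , σ) ⟶* (a , σ)) (sym (+-identityʳ b)) done , q

computes-assign : ∀ {r e σ} {Q : Store → Set} →
  (∀ σ′ → σ′ r ≡ eval σ e → (∀ c → c ≢ r → σ′ c ≡ σ c) → Q σ′) → Computes (assign r e) σ Q
computes-assign {r} {e} {σ} post prog b (at , _) =
  proj₂ c , perform at (subst (λ a → prog ⊢ c ⟶* (a , proj₂ c)) (+-comm 1 b) done) ,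
  post _ (after-same σ r e) (after-other σ r e)
  where c = execute (r ≔ e) (b , σ)

computes-⊕ : ∀ {A B σ} {Q R : Store → Set} →
  Computes A σ Q → (∀ σ′ → Q σ′ → Computes B σ′ R) → Computes (A ⊕ B) σ R
computes-⊕ {A} {B} {σ} cA cB prog b at =
  let atA , atB = At-++ prog b (A b) at
      σ₁ , run₁ , q = cA prog b atA
      σ₂ , run₂ , r = cB σ₁ q prog _ atB
      end = trans (+-assoc b _ _) (cong (b +_) (sym (length-++ (A b))))
  in σ₂ , subst (λ a → prog ⊢ (b , σ) ⟶* (a , σ₂)) end (⟶*-trans run₁ run₂) , r

-- The index of `I` is the number of iterations still to come, so invariant and termination measure
-- are one.
computes-until : ∀ {r s A} (I : ℕ → Store → Set) →
  (∀ σ → I 0 σ → σ r ≡ σ s) →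
  (∀ n σ → I (suc n) σ → σ r ≢ σ s × Computes A σ (I n)) →
  ∀ n σ → I n σ → Computes (until r s A) σ (I 0)
computes-until {r} {s} {A} I exit loop n σ i prog b (at₀ , at) = go n σ i
  where
  body = A (suc b)
  atBody = proj₁ (At-++ prog (suc b) body at)
  atBack = proj₁ (proj₂ (At-++ prog (suc b) body at))

  end : b + (2 + length body) ≡ b + length (until r s A b)
  end = cong (λ m → b + suc m) (trans (+-comm 1 _) (sym (length-++ body)))

  go : ∀ n σ → I n σ → Σ Store λ σ′ → prog ⊢ (b , σ) ⟶* (b + length (until r s A b) , σ′) × I 0 σ′
  go zero σ i = σ , jump at₀ (exit σ i) (subst (λ a → prog ⊢ (a , σ) ⟶* (b + length (until r s A b) , σ)) (sym end) done) , i
  go (suc n) σ i =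
    let r≢s , cA = loop n σ i
        σ₁ , run₁ , i₁ = cA prog (suc b) atBody
        σ₂ , run₂ , i₂ = go n σ₁ i₁
    in σ₂ , fallThrough at₀ r≢s (⟶*-trans run₁ (jump atBack refl run₂)) , i₂

-- Compilation of recursive functions

temporaries : ℕ → ∀ m → Vec ℕ m
temporaries fr zero    = []
temporaries fr (suc m) = fr ∷ temporaries (suc fr) m

-- compile f as fr reads its arguments from the registers as, leaves the result in register fr, and
-- writes to no register below fr.
mutual
  compile : ∀ {n} → PR n → Vec ℕ n → ℕ → Block
  compile zeroF          as       fr = assign fr zeroE
  compile succF          (a ∷ []) fr = assign fr (sucE a)
  compile (proj i)       as       fr = assign fr (reg (lookup as i))
  compile (comp {m} f gs) as      fr =
    compile* gs as fr ⊕ compile f (temporaries fr m) (m + fr) ⊕ assign fr (reg (m + fr))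
  compile (prec g h)     (a ∷ as) fr =
    compile g as fr ⊕ assign (suc fr) zeroE ⊕
    until (suc fr) a
      (compile h (suc fr ∷ fr ∷ as) (2 + fr) ⊕ assign fr (reg (2 + fr)) ⊕ assign (suc fr) (sucE (suc fr)))
  compile (mu f)         as       fr =
    assign fr zeroE ⊕ assign (suc fr) zeroE ⊕ compile f (fr ∷ as) (2 + fr) ⊕
    until (2 + fr) (suc fr) (assign fr (sucE fr) ⊕ compile f (fr ∷ as) (2 + fr))

  compile* : ∀ {m n} → Vec (PR n) m → Vec ℕ n → ℕ → Block
  compile* []       as fr = skip
  compile* (g ∷ gs) as fr = compile g as fr ⊕ compile* gs as (suc fr)

Frame : ℕ → Store → Store → Set
Frame fr σ σ′ = ∀ r → r < fr → σ′ r ≡ σ r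

frame-trans : ∀ {fr fr′ σ σ′ σ″} → fr ≤ fr′ → Frame fr σ σ′ → Frame fr′ σ′ σ″ → Frame fr σ σ″
frame-trans le f g r r<fr = trans (g r (<-≤-trans r<fr le)) (f r r<fr)

frame-assign : ∀ {fr r σ σ′} → fr ≤ r → (∀ c → c ≢ r → σ′ c ≡ σ c) → Frame fr σ σ′
frame-assign fr≤r other c c<fr = other c (<⇒≢ (<-≤-trans c<fr fr≤r))

map-frame : ∀ {fr σ σ′ n} {as : Vec ℕ n} → All (_< fr) as → Frame fr σ σ′ → V.map σ′ as ≡ V.map σ as
map-frame []       f = refl
map-frame (p ∷ ps) f = cong₂ _∷_ (f _ p) (map-frame ps f)

All-≤ : ∀ {m m′ n} {as : Vec ℕ n} → m ≤ m′ → All (_< m) as → All (_< m′) as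
All-≤ le []       = []
All-≤ le (p ∷ ps) = <-≤-trans p le ∷ All-≤ le ps

temporaries-< : ∀ fr m → All (_< m + fr) (temporaries fr m)
temporaries-< fr zero    = []
temporaries-< fr (suc m) =
  s≤s (m≤n+m fr m) ∷ subst (λ t → All (_< t) (temporaries (suc fr) m)) (+-suc m fr) (temporaries-< (suc fr) m)

Result : ℕ → ℕ → Store → Store → Set
Result fr y σ σ′ = σ′ fr ≡ y × Frame fr σ σ′

-- The iterations of h still to be done by a primitive recursion at stage i with accumulator r.
data Iterations {n} (h : PR (2 + n)) (xs : Vec ℕ n) (y : ℕ) : ℕ → ℕ → ℕ → Set where
  stop : ∀ {i} → Iterations h xs y 0 i y
  iter : ∀ {k i r r′} → h ⟦ i ∷ r ∷ xs ⟧↓ r′ → Iterations h xs y k (suc i) r′ → Iterations h xs y (suc k) i r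

iterations-snoc : ∀ {n} {h : PR (2 + n)} {xs y y′ k i r} →
  Iterations h xs y k i r → h ⟦ k + i ∷ y ∷ xs ⟧↓ y′ → Iterations h xs y′ (suc k) i r
iterations-snoc stop d = iter d stop
iterations-snoc {h = h} {xs} {y} {y′} {suc k} {i} (iter d ds) e =
  iter d (iterations-snoc ds (subst (λ j → h ⟦ j ∷ y ∷ xs ⟧↓ y′) (sym (+-suc k i)) e))

-- A derivation for `prec` has the last application of `h` outermost, while the loop performs the
-- first one first; hence the sequence is built by appending at its end.
iterations : ∀ {n} {g : PR n} {h x xs y} → prec g h ⟦ x ∷ xs ⟧↓ y →
  Σ ℕ λ r → g ⟦ xs ⟧↓ r × Iterations h xs y x 0 r
iterations (prec0↓ d) = _ , d , stop
iterations {h = h} {suc x} {xs} {y} (precS↓ {r = s} d e) =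
  let r , d′ , is = iterations d in
  r , d′ , iterations-snoc is (subst (λ j → h ⟦ j ∷ s ∷ xs ⟧↓ y) (sym (+-identityʳ x)) e)

mutual
  -- Induction on `f` rather than on the derivation, since the derivations for `h` come out of
  -- `iterations` and are not subterms of the given one.
  compile-correct : ∀ {n} (f : PR n) as fr σ {xs y} → All (_< fr) as → V.map σ as ≡ xs → f ⟦ xs ⟧↓ y →
    Computes (compile f as fr) σ (Result fr y σ)
  compile-correct zeroF as fr σ lt eq zero↓ =
    computes-assign λ σ′ p other → p , frame-assign ≤-refl other
  compile-correct succF (a ∷ []) fr σ lt refl succ↓ =
    computes-assign λ σ′ p other → p , frame-assign ≤-refl other
  compile-correct (proj i) as fr σ lt refl proj↓ =
    computes-assign λ σ′ p other → trans p (sym (lookup-map i σ as)) , frame-assign ≤-refl other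
  compile-correct (comp {m} f gs) as fr σ lt eq (comp↓ ds d) =
    computes-⊕ (compile*-correct gs as fr σ lt eq ds) λ σ₁ (eq₁ , frame₁) →
    computes-⊕ (compile-correct f _ (m + fr) σ₁ (temporaries-< fr m) eq₁ d) λ σ₂ (eq₂ , frame₂) →
    computes-assign λ σ₃ p other →
      trans p eq₂ ,
      frame-trans ≤-refl (frame-trans (m≤n+m fr m) frame₁ frame₂) (frame-assign ≤-refl other)
  compile-correct (prec g h) (a ∷ as) fr σ {y = y} (a<fr ∷ lt) refl D with iterations D
  ... | r₀ , d₀ , is₀ =
    computes-⊕ (compile-correct g as fr σ lt refl d₀) λ σ₁ (eq₁ , frame₁) →
    computes-⊕ (computes-assign {Q = Inv (σ a)} λ σ₂ p other →
      0 , r₀ , is₀ , +-identityʳ _ , p , trans (other fr (<⇒≢ (n<1+n fr))) eq₁ ,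
      frame-trans ≤-refl frame₁ (frame-assign (n≤1+n fr) other)) λ σ₂ inv →
    λ prog b at → let σ₃ , run , inv₃ = computes-until Inv exit loop (σ a) σ₂ inv prog b at in
      σ₃ , run , final σ₃ inv₃
    where
    -- Register `suc fr` counts up to the argument and `fr` accumulates; `k` is the distance still
    -- to go.
    Inv : ℕ → Store → Set
    Inv k τ = Σ ℕ λ i → Σ ℕ λ r → Iterations h (V.map σ as) y k i r × k + i ≡ σ a ×
      τ (suc fr) ≡ i × τ fr ≡ r × Frame fr σ τ

    final : ∀ τ → Inv 0 τ → Result fr y σ τ
    final τ (i , r , stop , _ , _ , p , frame) = p , frame

    exit : ∀ τ → Inv 0 τ → τ (suc fr) ≡ τ a
    exit τ (i , r , _ , i≡ , p , _ , frame) = trans p (trans i≡ (sym (frame a a<fr)))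

    loop : ∀ k τ → Inv (suc k) τ → τ (suc fr) ≢ τ a × Computes _ τ (Inv k)
    loop k τ (i , r , iter d ds , i≡ , p , q , frame) =
      (λ e → m≢1+n+m i (trans (sym p) (trans e (trans (frame a a<fr) (sym i≡))))) ,
      computes-⊕ (compile-correct h (suc fr ∷ fr ∷ as) (2 + fr) τ
        (n<1+n _ ∷ m<n⇒m<1+n (n<1+n fr) ∷ All-≤ (m≤n+m fr 2) lt)
        (cong₂ _∷_ p (cong₂ _∷_ q (map-frame lt frame))) d) λ τ₁ (eq₁ , frame₁) →
      computes-⊕ (computes-assign {Q = λ τ₂ → τ₂ fr ≡ _ × τ₂ (suc fr) ≡ i × Frame fr τ τ₂} λ τ₂ p₂ other →
        trans p₂ eq₁ ,
        trans (other (suc fr) λ ()) (trans (frame₁ (suc fr) (n<1+n _)) p) ,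
        frame-trans ≤-refl (λ r r< → frame₁ r (<-≤-trans r< (m≤n+m fr 2))) (frame-assign ≤-refl other))
        λ τ₂ (acc , cnt , frame₂) →
      computes-assign λ τ₃ p₃ other →
        suc i , _ , ds , trans (+-suc k i) i≡ , trans p₃ (cong suc cnt) ,
        trans (other fr (<⇒≢ (n<1+n fr))) acc ,
        frame-trans ≤-refl (frame-trans ≤-refl frame frame₂) (frame-assign (n≤1+n fr) other)
  compile-correct (mu f) as fr σ {xs} {y} lt refl (mu↓ d₀ ds) =
    computes-⊕ (computes-assign {Q = λ σ₁ → σ₁ fr ≡ 0 × Frame fr σ σ₁} λ σ₁ p other →
      p , frame-assign ≤-refl other) λ σ₁ (p₁ , frame₁) →
    computes-⊕ (computes-assign {Q = Ready 0} λ σ₂ p other →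
      trans (other fr (<⇒≢ (n<1+n fr))) p₁ , p , frame-trans ≤-refl frame₁ (frame-assign (n≤1+n fr) other))
      λ σ₂ ready →
    computes-⊕ (evaluate y 0 (+-identityʳ y) σ₂ ready) λ σ₃ inv →
    λ prog b at → let σ₄ , run , inv₄ = computes-until Inv exit loop y σ₃ inv prog b at in
      σ₄ , run , final σ₄ inv₄
    where
    Ready : ℕ → Store → Set
    Ready i τ = τ fr ≡ i × τ (suc fr) ≡ 0 × Frame fr σ τ

    -- `k` is the distance from the current candidate to the least zero `y`. Before `y` the values
    -- of `f` are successors, so the loop goes on.
    Outcome : ℕ → ℕ → Set
    Outcome zero    v = v ≡ 0
    Outcome (suc k) v = v ≢ 0

    Inv : ℕ → Store → Set
    Inv k τ = Σ ℕ λ i → k + i ≡ y × Outcome k (τ (2 + fr)) × Ready i τ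

    value : ∀ k i → k + i ≡ y → Σ ℕ λ v → f ⟦ i ∷ xs ⟧↓ v × Outcome k v
    value zero    i refl = 0 , d₀ , refl
    value (suc k) i refl = let r , d = ds i (s≤s (m≤n+m i k)) in suc r , d , λ ()

    evaluate : ∀ k i → k + i ≡ y → ∀ τ → Ready i τ → Computes (compile f (fr ∷ as) (2 + fr)) τ (Inv k)
    evaluate k i k+i≡y τ (p , z , frame) with value k i k+i≡y
    ... | v , d , o = λ prog b at →
      let τ₁ , run , eq₁ , frame₁ = compile-correct f (fr ∷ as) (2 + fr) τ
            (m<n⇒m<1+n (n<1+n fr) ∷ All-≤ (m≤n+m fr 2) lt) (cong₂ _∷_ p (map-frame lt frame)) d prog b at
      in τ₁ , run , i , k+i≡y , subst (Outcome k) (sym eq₁) o ,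
         trans (frame₁ fr (m<n⇒m<1+n (n<1+n fr))) p , trans (frame₁ (suc fr) (n<1+n _)) z ,
         frame-trans (m≤n+m fr 2) frame frame₁

    final : ∀ τ → Inv 0 τ → Result fr y σ τ
    final τ (i , refl , _ , p , _ , frame) = p , frame

    exit : ∀ τ → Inv 0 τ → τ (2 + fr) ≡ τ (suc fr)
    exit τ (i , _ , o , _ , z , _) = trans o (sym z)

    loop : ∀ k τ → Inv (suc k) τ → τ (2 + fr) ≢ τ (suc fr) × Computes _ τ (Inv k)
    loop k τ (i , i≡ , o , p , z , frame) =
      (λ e → o (trans e z)) ,
      computes-⊕ (computes-assign {Q = Ready (suc i)} λ τ₁ p₁ other →
        trans p₁ (cong suc p) , trans (other (suc fr) (λ e → <⇒≢ (n<1+n fr) (sym e))) z ,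
        frame-trans ≤-refl frame (frame-assign ≤-refl other))
      (evaluate k (suc i) (trans (+-suc k i) i≡))

  compile*-correct : ∀ {m n} (gs : Vec (PR n) m) as fr σ {xs ys} → All (_< fr) as → V.map σ as ≡ xs →
    gs ⟦ xs ⟧↓* ys →
    Computes (compile* gs as fr) σ (λ σ′ → V.map σ′ (temporaries fr m) ≡ ys × Frame fr σ σ′)
  compile*-correct [] as fr σ lt eq []↓ = computes-skip (refl , λ _ _ → refl)
  compile*-correct (g ∷ gs) as fr σ lt eq (d ∷↓ ds) =
    computes-⊕ (compile-correct g as fr σ lt eq d) λ σ₁ (eq₁ , frame₁) →
    λ prog b at →
      let σ₂ , run , eq₂ , frame₂ = compile*-correct gs as (suc fr) σ₁ (All-≤ (n≤1+n fr) lt)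
            (trans (map-frame lt frame₁) eq) ds prog b at
      in σ₂ , run , cong₂ _∷_ (trans (frame₂ fr (n<1+n fr)) eq₁) eq₂ , frame-trans (n≤1+n fr) frame₁ frame₂

-- The machine of a recursive function

-- After the body, register 1 holds the result and register 2 is cleared for the comparison. A
-- result of 0 jumps over `fail` to `halt`, at address `3 + length body`.
program : PR 1 → List Instr
program g = body ++ (2 ≔ zeroE) ∷ jumpEq 1 2 (3 + length body) ∷ fail ∷ halt ∷ []
  where body = compile g (0 ∷ []) 1 0

-- Every register starts with the input, so the initial store is described by equating all registers
-- with register 0. Compiled code is correct from any store with the right argument.
initial : ℕ → Config
initial n = 0 , λ _ → n

module _ (g : PR 1) where
  private
    end = length (compile g (0 ∷ []) 1 0)

    at = At-++ (program g) 0 (compile g (0 ∷ []) 1 0) (At-suffix [] (program g))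

    atEnd = proj₂ at

  program-run : ∀ {n y} → g ⟦ n ∷ [] ⟧↓ y →
    Σ Store λ σ → program g ⊢ initial n ⟶* (suc end , σ) × σ 1 ≡ y × σ 2 ≡ 0
  program-run {n} d =
    let σ , run , r , _ = compile-correct g (0 ∷ []) 1 (λ _ → n) (s≤s z≤n ∷ []) refl d (program g) 0 (proj₁ at)
    in _ , ⟶*-trans run (perform (proj₁ atEnd) done) , r , refl

  program-accepts : ∀ {n} → g ⟦ n ∷ [] ⟧↓ 0 →
    Σ Config λ c → program g ⊢ initial n ⟶* c × fetch (program g) (proj₁ c) ≡ halt
  program-accepts d =
    let σ , run , r , z = program-run d in
    _ , ⟶*-trans run (jump (proj₁ (proj₂ atEnd)) (trans r (sym z)) done) , proj₁ (proj₂ (proj₂ (proj₂ atEnd)))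

  program-rejects : ∀ {n y} → g ⟦ n ∷ [] ⟧↓ suc y →
    Σ Config λ c → program g ⊢ initial n ⟶* c × fetch (program g) (proj₁ c) ≡ fail
  program-rejects d =
    let σ , run , r , z = program-run d in
    _ , ⟶*-trans run (fallThrough (proj₁ (proj₂ atEnd)) (λ e → 1+n≢0 (trans (sym r) (trans e z))) done) ,
    proj₁ (proj₂ (proj₂ atEnd))

-- Bounds on the registers read by a program

RegsBelow : ℕ → Expr → Set
RegsBelow K zeroE    = ⊤
RegsBelow K (reg r)  = r < K
RegsBelow K (sucE r) = r < K

InstrBelow : ℕ → Instr → Set
InstrBelow K (r ≔ e)        = RegsBelow K e
InstrBelow K (jumpEq r s a) = r < K × s < K
InstrBelow K halt           = ⊤
InstrBelow K fail           = ⊤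

maxReg : Instr → ℕ
maxReg (r ≔ zeroE)    = 0
maxReg (r ≔ reg s)    = s
maxReg (r ≔ sucE s)   = s
maxReg (jumpEq r s a) = r ⊔ s
maxReg halt           = 0
maxReg fail           = 0

registers : List Instr → ℕ
-- At least one register is counted, because the input enters through register 0.
registers []       = 1
registers (I ∷ is) = suc (maxReg I) ⊔ registers is

registers>0 : ∀ is → 0 < registers is
registers>0 []       = s≤s z≤n
registers>0 (I ∷ is) = <-≤-trans (registers>0 is) (m≤n⊔m _ (registers is))

maxReg-below : ∀ {K} I → maxReg I < K → InstrBelow K I
maxReg-below (r ≔ zeroE)    p = tt
maxReg-below (r ≔ reg s)    p = p
maxReg-below (r ≔ sucE s)   p = p
maxReg-below (jumpEq r s a) p = ≤-<-trans (m≤m⊔n r s) p , ≤-<-trans (m≤n⊔m r s) p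
maxReg-below halt           p = tt
maxReg-below fail           p = tt

fetch-maxReg : ∀ is a → maxReg (fetch is a) < registers is
fetch-maxReg []       a       = s≤s z≤n
fetch-maxReg (I ∷ is) zero    = m≤m⊔n _ (registers is)
fetch-maxReg (I ∷ is) (suc a) = <-≤-trans (fetch-maxReg is a) (m≤n⊔m _ (registers is))

fetch-below : ∀ is a → InstrBelow (registers is) (fetch is a)
fetch-below is a = maxReg-below (fetch is a) (fetch-maxReg is a)

after-below : ∀ {K} I c → InstrBelow K I → c < K → RegsBelow K (after I c)
after-below (r ≔ e) c p q with c ≟ r
... | yes _ = p
... | no _  = q
after-below (jumpEq r s a) c p q = q
after-below halt c p q = q
after-below fail c p q = q

fetch-beyond : ∀ is a → length is ≤ a → fetch is a ≡ halt
fetch-beyond []       a       p       = refl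
fetch-beyond (I ∷ is) (suc a) (s≤s p) = fetch-beyond is a p

-- Recursive arithmetic of Gödel numbers

constant : ∀ {n} → ℕ → PR n
constant zero    = zeroF
constant (suc k) = comp succF (constant k ∷ [])

constant↓ : ∀ {n} k {xs : Vec ℕ n} → constant k ⟦ xs ⟧↓ k
constant↓ zero    = zero↓
constant↓ (suc k) = comp↓ (constant↓ k ∷↓ []↓) succ↓

pattern #0 = F.zero
pattern #1 = F.suc F.zero
pattern #2 = F.suc (F.suc F.zero)

addPR : PR 2
addPR = prec (proj #0) (comp succF (proj #1 ∷ []))

addPR↓ : ∀ x y → addPR ⟦ x ∷ y ∷ [] ⟧↓ (x + y)
addPR↓ zero    y = prec0↓ proj↓
addPR↓ (suc x) y = precS↓ (addPR↓ x y) (comp↓ (proj↓ ∷↓ []↓) succ↓)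

mulPR : PR 2
mulPR = prec zeroF (comp addPR (proj #2 ∷ proj #1 ∷ []))

mulPR↓ : ∀ x y → mulPR ⟦ x ∷ y ∷ [] ⟧↓ (x * y)
mulPR↓ zero    y = prec0↓ zero↓
mulPR↓ (suc x) y = precS↓ (mulPR↓ x y) (comp↓ (proj↓ ∷↓ (proj↓ ∷↓ []↓)) (addPR↓ y (x * y)))

pow2PR : PR 1
pow2PR = prec (constant 1) (comp mulPR (constant 2 ∷ proj #1 ∷ []))

pow2PR↓ : ∀ x → pow2PR ⟦ x ∷ [] ⟧↓ (2 ^ x)
pow2PR↓ zero    = prec0↓ (constant↓ 1)
pow2PR↓ (suc x) = precS↓ (pow2PR↓ x) (comp↓ (constant↓ 2 ∷↓ (proj↓ ∷↓ []↓)) (mulPR↓ 2 (2 ^ x)))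

predPR : PR 1
predPR = prec zeroF (proj #0)

predPR↓ : ∀ x → predPR ⟦ x ∷ [] ⟧↓ (x ∸ 1)
predPR↓ zero    = prec0↓ zero↓
predPR↓ (suc x) = precS↓ (predPR↓ x) proj↓

pairPR : ∀ {n} → PR n → PR n → PR n
pairPR f g = comp predPR (comp mulPR (comp pow2PR (f ∷ []) ∷
  comp addPR (comp mulPR (constant 2 ∷ g ∷ []) ∷ constant 1 ∷ []) ∷ []) ∷ [])

pairPR↓ : ∀ {n} {f g : PR n} {xs} a b → f ⟦ xs ⟧↓ a → g ⟦ xs ⟧↓ b → pairPR f g ⟦ xs ⟧↓ pair a b
pairPR↓ a b d e = comp↓ (comp↓
  (comp↓ (d ∷↓ []↓) (pow2PR↓ a) ∷↓
  (comp↓ (comp↓ (constant↓ 2 ∷↓ (e ∷↓ []↓)) (mulPR↓ 2 b) ∷↓ (constant↓ 1 ∷↓ []↓)) (addPR↓ (2 * b) 1) ∷↓ []↓))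
  (mulPR↓ (2 ^ a) (2 * b + 1)) ∷↓ []↓) (predPR↓ (2 ^ a * (2 * b + 1)))

-- For `P` and `mark zeroM` this is the numeral `n`: zero is reached in `n` predecessor steps. Its
-- code is obtained by one primitive recursion on `n`.
iterate◇ : Prog → Form → ℕ → Form
iterate◇ π φ zero    = φ
iterate◇ π φ (suc n) = ⟨ π ⟩ iterate◇ π φ n

iterate◇PR : ℕ → ℕ → PR 1
iterate◇PR p c = prec (constant c) (pairPR (constant 4) (pairPR (constant p) (proj #1)))

iterate◇PR↓ : ∀ π φ n → iterate◇PR (codeP π) (code φ) ⟦ n ∷ [] ⟧↓ code (iterate◇ π φ n)
iterate◇PR↓ π φ zero    = prec0↓ (constant↓ (code φ))
iterate◇PR↓ π φ (suc n) = precS↓ (iterate◇PR↓ π φ n)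
  (pairPR↓ 4 _ (constant↓ 4) (pairPR↓ (codeP π) (code (iterate◇ π φ n)) (constant↓ (codeP π)) proj↓))

withInput : Prog → Prog → Form → Form → ℕ → Form
withInput ρ π φ χ n = χ ∧f (⟨ ρ ⟩ iterate◇ π φ n)

-- The argument is used twice: as the code of the first conjunct and as the input on which
-- `iterate◇PR` recurses.
diagonalPR : ℕ → ℕ → ℕ → PR 1
diagonalPR r p c = pairPR (constant 2) (pairPR (proj #0) (pairPR (constant 4) (pairPR (constant r) (iterate◇PR p c))))

diagonalPR↓ : ∀ ρ π φ χ →
  diagonalPR (codeP ρ) (codeP π) (code φ) ⟦ code χ ∷ [] ⟧↓ code (withInput ρ π φ χ (code χ))
diagonalPR↓ ρ π φ χ =
  pairPR↓ 2 _ (constant↓ 2) (pairPR↓ (code χ) _ proj↓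
    (pairPR↓ 4 _ (constant↓ 4) (pairPR↓ (codeP ρ) _ (constant↓ (codeP ρ)) (iterate◇PR↓ π φ (code χ)))))

-- The formula describing a run

data Mark : Set where
  hubM zeroM      : Mark
  outM inM stateM : ℕ → Mark

encode : Mark → ℕ
encode hubM       = 0
encode zeroM      = 1
encode (outM c)   = 2 + c * 3
encode (inM c)    = 3 + c * 3
encode (stateM c) = 4 + c * 3

bump : Mark → Mark
bump (outM c)   = outM (suc c)
bump (inM c)    = inM (suc c)
bump (stateM c) = stateM (suc c)
bump m          = m

decode-indexed : ℕ → Mark
decode-indexed 0 = outM 0
decode-indexed 1 = inM 0
decode-indexed 2 = stateM 0
decode-indexed (suc (suc (suc n))) = bump (decode-indexed n)

decode : ℕ → Mark
decode 0             = hubM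
decode 1             = zeroM
decode (suc (suc n)) = decode-indexed n

-- Allows the labels of the model to be defined by cases on marks instead of on numbers.
decode-encode : ∀ m → decode (encode m) ≡ m
decode-encode hubM             = refl
decode-encode zeroM            = refl
decode-encode (outM zero)      = refl
decode-encode (outM (suc c))   = cong bump (decode-encode (outM c))
decode-encode (inM zero)       = refl
decode-encode (inM (suc c))    = cong bump (decode-encode (inM c))
decode-encode (stateM zero)    = refl
decode-encode (stateM (suc c)) = cong bump (decode-encode (stateM c))

mark : Mark → Form
mark m = prop (encode m)

⋀ : ℕ → (ℕ → Form) → Form
⋀ zero    φ = ⊤f
⋀ (suc n) φ = φ n ∧f ⋀ n φ

-- Equality of two terms: each program has a target and their union has only one, so both have
-- exactly that target.
same : Prog → Prog → Form
same π ρ = (⟨ π ⟩ ⊤f) ∧f ((⟨ ρ ⟩ ⊤f) ∧f (⟨ π ∪p ρ ⟩⁼¹ ⊤f))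

-- A box over a test is an implication, so nothing is claimed at nodes without a target.
atMostOne : Prog → Form
atMostOne π = [ test (⟨ π ⟩ ⊤f) ] (⟨ π ⟩⁼¹ ⊤f)

element : Form
element = ⟨ step ⟩ mark hubM

-- A directed edge x → y of the c-th relation is an undirected path x – out – in – y.
arrow : ℕ → ℕ → Prog
arrow a b = step ⨾ (test (prop a) ⨾ (step ⨾ (test (prop b) ⨾ (step ⨾ test element))))

forth back : ℕ → Prog
forth c = arrow (encode (outM c)) (encode (inM c))
back  c = arrow (encode (inM c)) (encode (outM c))

-- Elements serve both as numbers and as instants of time; register c at time x is the number reached by R c.
S P : Prog
S = forth 0
P = back 0

R : ℕ → Prog
R c = forth (suc c)

toZero : Prog
toZero = step ⨾ (test (mark hubM) ⨾ (step ⨾ test (mark zeroM)))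

value : Expr → Prog
value zeroE    = toZero
value (reg r)  = R r
value (sucE r) = R r ⨾ S

goto : ℕ → Form
goto a = ⟨ S ⟩ mark (stateM a)

-- `S ⨾ R c` reads register `c` at the next instant; the expression from `after` is evaluated at the
-- present one.
updates : ℕ → Instr → Form
updates K I = ⋀ K λ c → same (S ⨾ R c) (value (after I c))

instruction : ℕ → ℕ → Instr → Form
instruction K pc (r ≔ e) = goto (suc pc) ∧f updates K (r ≔ e)
instruction K pc (jumpEq r s a) =
  (([ test (same (R r) (R s)) ] goto a) ∧f ([ test (¬f same (R r) (R s)) ] goto (suc pc))) ∧f
  updates K (jumpEq r s a)
-- A halted instant asks for no successor, which lets the model be finite.
instruction K pc halt = ⊤f
instruction K pc fail = ¬f ⊤f

-- All relations lead from neighbours of a hub to neighbours of a hub in three steps, so this keeps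
-- them among the neighbours of a single hub.
oneHub : Form
oneHub = ⟨ step ∪p (step ⨾ (step ⨾ (step ⨾ step))) ⟩⁼¹ mark hubM

local : List Instr → Form
local prog =
  oneHub ∧f
  (atMostOne S ∧f
  (atMostOne P ∧f
  (([ test (mark zeroM) ] (¬f (⟨ P ⟩ ⊤f))) ∧f
  (([ test (mark zeroM) ] (mark (stateM 0) ∧f ⋀ (registers prog) λ c → same (R c) (R 0))) ∧f
  ⋀ (length prog) λ a → [ test (mark (stateM a)) ] instruction (registers prog) a (fetch prog a)))))

describe : List Instr → Form
describe prog = mark hubM ∧f ((⟨ step ⟩⁼¹ mark zeroM) ∧f ([ step ] local prog))

input : Prog
input = step ⨾ (test (mark zeroM) ⨾ R 0)

-- Semantics of the derived formulas

module Derived {X : Set} (edge : X → X → Bool) (label : X → ℕ → Bool) where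
  open Relational edge label

  Is : Prog → X → X → Set
  Is π x y = Path π x y × (∀ z → Path π x z → z ≡ y)

  Is-⨾ : ∀ {π ρ x y z} → Is π x y → Is ρ y z → Is (π ⨾ ρ) x z
  Is-⨾ {ρ = ρ} (p , u) (q , v) =
    (_ , p , q) , λ w (w′ , p′ , q′) → v w (subst (λ t → Path ρ t w) (u w′ p′) q′)

  same⁺ : ∀ π ρ {x y} → Is π x y → Is ρ x y → Holds (same π ρ) x
  same⁺ π ρ (p , u) (q , v) =
    (_ , p , tt) , (_ , q , tt) , _ , (inj₁ p , tt) , λ { z (inj₁ r) _ → u z r ; z (inj₂ r) _ → v z r }

  same⁻ : ∀ π ρ {x} → Holds (same π ρ) x → Σ X λ y → Is π x y × Is ρ x y
  same⁻ π ρ {x} ((y , p , _) , (z , q , _) , w , _ , u) =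
    w , (subst (Path π x) (u y (inj₁ p) tt) p , λ v r → u v (inj₁ r) tt) ,
        (subst (Path ρ x) (u z (inj₂ q) tt) q , λ v r → u v (inj₂ r) tt)

  ⋀⁺ : ∀ n φ {x} → (∀ c → c < n → Holds (φ c) x) → Holds (⋀ n φ) x
  ⋀⁺ zero    φ h = tt
  ⋀⁺ (suc n) φ h = h n ≤-refl , ⋀⁺ n φ λ c c<n → h c (m<n⇒m<1+n c<n)

  ⋀⁻ : ∀ n φ {x} → Holds (⋀ n φ) x → ∀ c → c < n → Holds (φ c) x
  ⋀⁻ (suc n) φ (h , hs) c c<1+n with m<1+n⇒m<n∨m≡n c<1+n
  ... | inj₁ c<n  = ⋀⁻ n φ hs c c<n
  ... | inj₂ refl = h

  Arrow : ℕ → ℕ → X → X → Set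
  Arrow a b x y = Σ X λ p → Σ X λ q →
    Edge x p × Holds (prop a) p × Edge p q × Holds (prop b) q × Edge q y × Holds element y

  arrow⁺ : ∀ {a b x y} → Arrow a b x y → Path (arrow a b) x y
  arrow⁺ (p , q , e₁ , m , e₂ , m′ , e₃ , el) = p , e₁ , p , (refl , m) , q , e₂ , q , (refl , m′) , _ , e₃ , refl , el

  arrow⁻ : ∀ {a b x y} → Path (arrow a b) x y → Arrow a b x y
  arrow⁻ (p , e₁ , .p , (refl , m) , q , e₂ , .q , (refl , m′) , _ , e₃ , refl , el) =
    p , q , e₁ , m , e₂ , m′ , e₃ , el

  atMostOne⁺ : ∀ π {x} → (∀ y z → Path π x y → Path π x z → z ≡ y) → Holds (atMostOne π) x
  atMostOne⁺ π u _ (refl , y , p , _) = y , (p , tt) , λ z q _ → u y z p q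

  atMostOne⁻ : ∀ π {x} → Holds (atMostOne π) x → ∀ y z → Path π x y → Path π x z → z ≡ y
  atMostOne⁻ π {x} h y z p q =
    let w , _ , u = h x (refl , y , p , tt) in trans (u z q tt) (sym (u y p tt))

-- From models to runs

module Soundness {X : Set} (edge : X → X → Bool) (label : X → ℕ → Bool)
  (edge-sym : ∀ x y → edge x y ≡ edge y x) (prog : List Instr) (hub : X) where

  open Relational edge label
  open Derived edge label

  module _ (describes : Holds (describe prog) hub) where

    K = registers prog

    Near : X → Set
    Near x = Edge hub x

    flip : ∀ {x y} → Edge x y → Edge y x
    flip {x} {y} e = trans (edge-sym y x) e

    near-local : ∀ {x} → Near x → Holds (local prog) x
    near-local {x} e = proj₂ (proj₂ describes) x e

    near-element : ∀ {x} → Near x → Holds element x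
    near-element e = hub , flip e , proj₁ describes

    hub-unique : ∀ {x y} → Near x → Edge x y → Holds (mark hubM) y → y ≡ hub
    hub-unique e f h =
      let _ , _ , u = proj₁ (near-local e) in
      trans (u _ (inj₁ f) h) (sym (u hub (inj₁ (flip e)) (proj₁ describes)))

    -- The target has some hub as a neighbour, and that hub is four steps away from `x`; `oneHub` at
    -- `x` identifies it with the fixed one.
    near-arrow : ∀ {a b x y} → Near x → Path (arrow a b) x y → Near y
    near-arrow e p with arrow⁻ p
    ... | p , q , e₁ , _ , e₂ , _ , e₃ , h , e₄ , m =
      let _ , _ , u = proj₁ (near-local e) in
      flip (subst (Edge _) (trans (u h (inj₂ (p , e₁ , q , e₂ , _ , e₃ , e₄)) m)
        (sym (u hub (inj₁ (flip e)) (proj₁ describes)))) e₄)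

    -- Edges are undirected, so the same two ports are passed in the opposite order.
    reverse : ∀ {a b x y} → Near x → Path (arrow a b) x y → Path (arrow b a) y x
    reverse e p with arrow⁻ p
    ... | p , q , e₁ , m , e₂ , m′ , e₃ , _ =
      arrow⁺ (q , p , flip e₃ , m′ , flip e₂ , m , flip e₁ , near-element e)

    S-functional : ∀ {x y z} → Near x → Path S x y → Path S x z → z ≡ y
    S-functional e p q = atMostOne⁻ S (proj₁ (proj₂ (near-local e))) _ _ p q

    -- Reversed, both arrows become `P`-paths out of `x`, where `P` has at most one target.
    S-injective : ∀ {x y z} → Near y → Near z → Path S y x → Path S z x → z ≡ y
    S-injective e f p q =
      atMostOne⁻ P (proj₁ (proj₂ (proj₂ (near-local (near-arrow e p))))) _ _ (reverse e p) (reverse f q)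

    -- A relation rather than a function: a model may contain elements that no chain from zero
    -- reaches.
    data Number : ℕ → X → Set where
      zeroN : ∀ {x} → Near x → Holds (mark zeroM) x → Number 0 x
      sucN  : ∀ {m x y} → Number m x → Path S x y → Number (suc m) y

    number-near : ∀ {m x} → Number m x → Near x
    number-near (zeroN e _) = e
    number-near (sucN a p)  = near-arrow (number-near a) p

    zero-not-suc : ∀ {m x y} → Holds (mark zeroM) y → Number m x → ¬ Path S x y
    zero-not-suc {x = x} {y} z a p =
      proj₁ (proj₂ (proj₂ (proj₂ (near-local (near-arrow (number-near a) p))))) y (refl , z)
        (x , reverse (number-near a) p , tt)

    number-functional : ∀ {m x y} → Number m x → Number m y → x ≡ y
    number-functional (zeroN e z) (zeroN e′ z′) =
      let _ , _ , u = proj₁ (proj₂ describes) in trans (u _ e z) (sym (u _ e′ z′))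
    number-functional (sucN a p) (sucN b q) with number-functional a b
    ... | refl = S-functional (number-near a) q p

    -- Zero has no predecessor and `S` is injective, so the chain from zero never returns to an
    -- earlier element. Hence registers with different contents have different targets.
    number-injective : ∀ {m n x} → Number m x → Number n x → m ≡ n
    number-injective (zeroN _ _) (zeroN _ _) = refl
    number-injective (zeroN _ z) (sucN b q)  = ⊥-elim (zero-not-suc z b q)
    number-injective (sucN a p)  (zeroN _ z) = ⊥-elim (zero-not-suc z a p)
    number-injective (sucN a p)  (sucN b q) with S-injective (number-near b) (number-near a) q p
    ... | refl = cong suc (number-injective a b)

    numeral-number : ∀ n {x} → Near x → Holds (iterate◇ P (mark zeroM) n) x → Number n x
    numeral-number zero    e h = zeroN e h
    numeral-number (suc n) e (y , p , h) = sucN (numeral-number n (near-arrow e p) h) (reverse e p)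

    Registers : Store → X → Set
    Registers σ x = ∀ c → c < K → Σ X λ v → Is (R c) x v × Number (σ c) v

    Represents : Config → X → Set
    Represents (pc , σ) x = Near x × Holds (mark (stateM pc)) x × Registers σ x

    value-number : ∀ {σ x v} e → Near x → Registers σ x → RegsBelow K e →
      Path (value e) x v → Number (eval σ e) v
    value-number zeroE near regs _ (h , e₁ , .h , (refl , m) , v , e₂ , refl , z) =
      zeroN (subst (λ h → Edge h v) (hub-unique near e₁ m) e₂) z
    value-number (reg r) near regs r<K p =
      let v , (_ , u) , a = regs r r<K in subst (Number _) (sym (u _ p)) a
    value-number (sucE r) near regs r<K (w , p , q) =
      let v , (_ , u) , a = regs r r<K in sucN (subst (Number _) (sym (u _ p)) a) q

    -- The formula itself supplies the new contents: `same` yields a common target, which is the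
    -- register's value at `y` by the first program and has the right number by the second.
    advance : ∀ {σ x y} I → InstrBelow K I → Near x → Registers σ x → Path S x y →
      Holds (updates K I) x → Registers (λ c → eval σ (after I c)) y
    advance {σ} {x} {y} I below near regs p h c c<K
      with same⁻ (S ⨾ R c) (value (after I c)) (⋀⁻ K (λ c → same (S ⨾ R c) (value (after I c))) h c c<K)
    ... | v , ((z , q , r) , u) , (s , _) =
      v , (subst (λ t → Path (R c) t v) (S-functional near p q) r , λ w t → u w (y , p , t)) ,
      value-number (after I c) near regs (after-below I c below c<K) s

    same-values : ∀ {σ x r s} → Registers σ x → r < K → s < K → σ r ≡ σ s → Holds (same (R r) (R s)) x
    same-values {σ} {x} {r} {s} regs r<K s<K eq =
      let v , is , a = regs r r<K
          w , is′ , b = regs s s<K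
      in same⁺ (R r) (R s) is (subst (Is (R s) x) (number-functional b (subst (λ m → Number m v) eq a)) is′)

    different-values : ∀ {σ x r s} → Registers σ x → r < K → s < K → σ r ≢ σ s → ¬ Holds (same (R r) (R s)) x
    different-values {σ} {x} {r} {s} regs r<K s<K neq h =
      let v , (p , u) , a = regs r r<K
          w , (q , u′) , b = regs s s<K
          y , (p′ , _) , (q′ , _) = same⁻ (R r) (R s) h
      in neq (number-injective (subst (Number _) (sym (u y p′)) a) (subst (Number _) (sym (u′ y q′)) b))

    instruction-holds : ∀ {x} pc → Near x → Holds (mark (stateM pc)) x → Holds (instruction K pc (fetch prog pc)) x
    instruction-holds {x} pc near h with pc <? length prog
    ... | yes p = ⋀⁻ (length prog)
      (λ a → [ test (mark (stateM a)) ] instruction K a (fetch prog a))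
      (proj₂ (proj₂ (proj₂ (proj₂ (proj₂ (near-local near)))))) pc p x (refl , h)
    ... | no ¬p rewrite fetch-beyond prog pc (≮⇒≥ ¬p) = tt

    execute-represents : ∀ {pc σ x} I → InstrBelow K I → Holds (instruction K pc I) x →
      Represents (pc , σ) x → Σ X λ y → Represents (execute I (pc , σ)) y
    execute-represents (r ≔ e) below ((y , p , h) , us) (near , _ , regs) =
      y , near-arrow near p , h , advance (r ≔ e) below near regs p us
    execute-represents {pc} {σ} {x} (jumpEq r s a) below ((yes-branch , no-branch) , us) (near , _ , regs) =
      let y , p , h = branch in y , near-arrow near p , h , advance (jumpEq r s a) below near regs p us
      where
      branch : Holds (goto (target (jumpEq r s a) pc σ)) x
      branch with σ r ≟ σ s
      ... | yes eq = yes-branch x (refl , same-values regs (proj₁ below) (proj₂ below) eq)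
      ... | no neq = no-branch x (refl , different-values regs (proj₁ below) (proj₂ below) neq)
    -- `halt` leaves the configuration unchanged, so the same element still represents it.
    execute-represents halt below h rep = _ , rep
    execute-represents fail below h rep = ⊥-elim (h tt)

    run-represents : ∀ {c c′ x} → prog ⊢ c ⟶* c′ → Represents c x → Σ X λ y → Represents c′ y
    run-represents done rep = _ , rep
    run-represents {pc , σ} (more run) rep@(near , h , _) =
      run-represents run (proj₂ (execute-represents (fetch prog pc) (fetch-below prog pc)
        (instruction-holds pc near h) rep))

    no-fail : ∀ {c x} → Represents c x → fetch prog (proj₁ c) ≢ fail
    no-fail {pc , σ} {x} (near , h , _) eq =
      subst (λ I → Holds (instruction K pc I) x) eq (instruction-holds pc near h) tt

    initial-represents : ∀ n → Holds (⟨ input ⟩ iterate◇ P (mark zeroM) n) hub →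
      Σ X λ x → Represents (initial n) x
    initial-represents n (v , (x , near , .x , (refl , z) , p) , h) =
      x , near , proj₁ init , λ c c<K →
        let w , is , (_ , u) = same⁻ (R c) (R 0) (⋀⁻ K (λ c → same (R c) (R 0)) (proj₂ init) c c<K) in
        w , is , subst (Number n) (u v p) (numeral-number n (near-arrow near p) h)
      where init = proj₁ (proj₂ (proj₂ (proj₂ (proj₂ (near-local near))))) x (refl , z)

satisfiable-no-fail : ∀ prog n {c} → Satisfiable (withInput input P (mark zeroM) (describe prog) n) →
  prog ⊢ initial n ⟶* c → fetch prog (proj₁ c) ≢ fail
satisfiable-no-fail prog n (k , G , u , sat) run =
  let h , i = holds⁺ (withInput input P (mark zeroM) (describe prog) n) u sat
      x , rep = initial-represents h n i
  in no-fail h (proj₂ (run-represents h run rep))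
  where
  open Graph G
  open Reflection E lab G (λ v → v) (λ v → v) (λ _ → refl) (λ _ → refl) (λ _ _ → refl) (λ _ _ → refl)
  open Soundness E lab symm prog u

-- From halting runs to models

run : List Instr → Config → ℕ → Config
run prog c zero    = c
run prog c (suc t) = next prog (run prog c t)

run-next : ∀ prog c t → run prog (next prog c) t ≡ next prog (run prog c t)
run-next prog c zero    = refl
run-next prog c (suc t) = cong (next prog) (run-next prog c t)

⟶*⇒run : ∀ {prog c c′} → prog ⊢ c ⟶* c′ → Σ ℕ λ t → run prog c t ≡ c′
⟶*⇒run done = 0 , refl
⟶*⇒run {prog} {c} (more p) = let t , eq = ⟶*⇒run p in suc t , trans (sym (run-next prog c t)) eq

run-stationary : ∀ prog c {i j} → next prog (run prog c i) ≡ run prog c i → i ≤ j → run prog c j ≡ run prog c i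
run-stationary prog c {zero}  {zero}  eq le = refl
run-stationary prog c {i} {suc j} eq le with m≤n⇒m<n∨m≡n le
... | inj₂ refl = refl
... | inj₁ (s≤s i≤j) = trans (cong (next prog) (run-stationary prog c eq i≤j)) eq

next-at : ∀ prog c {I} → fetch prog (proj₁ c) ≡ I → next prog c ≡ execute I c
next-at prog c refl = refl

execute-bounded : ∀ I c {m} → (∀ r → proj₂ c r ≤ m) → ∀ r → proj₂ (execute I c) r ≤ suc m
execute-bounded I (pc , σ) {m} bnd r = bound (after I r)
  where
  bound : ∀ e → eval σ e ≤ suc m
  bound zeroE    = z≤n
  bound (reg r)  = m≤n⇒m≤1+n (bnd r)
  bound (sucE r) = s≤s (bnd r)

-- An instruction raises a content by at most one. The bound fixes the number of elements of the
-- model.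
run-bounded : ∀ prog n t c → proj₂ (run prog (initial n) t) c ≤ n + t
run-bounded prog n zero    c = m≤m+n n 0
run-bounded prog n (suc t) c = subst (proj₂ (run prog (initial n) (suc t)) c ≤_) (sym (+-suc n t))
  (execute-bounded (fetch prog (proj₁ (run prog (initial n) t))) (run prog (initial n) t) (run-bounded prog n t) c)

module Completeness (prog : List Instr) (n T : ℕ)
  (halts : fetch prog (proj₁ (run prog (initial n) T)) ≡ halt) where

  config : ℕ → Config
  config = run prog (initial n)

  -- The elements are the numbers up to `n + T`: enough for the instants up to `T` and for all
  -- contents at those instants.
  K N : ℕ
  K = registers prog
  N = suc (n + T)

  -- Besides the hub, each number has an element and two ports for each of the `suc K` relations.
  -- Sums and products make the bijection with `Fin size` a composite of standard ones.
  Node : Set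
  Node = ⊤ ⊎ (Fin N × (⊤ ⊎ (Fin (suc K) ⊎ Fin (suc K))))

  pattern hub     = inj₁ tt
  pattern el i    = inj₂ (i , inj₁ tt)
  pattern out i c = inj₂ (i , inj₂ (inj₁ c))
  pattern inn i c = inj₂ (i , inj₂ (inj₂ c))

  size : ℕ
  size = 1 + N * (1 + (suc K + suc K))

  nodes : Fin size ↔ Node
  nodes = ↔-trans +↔⊎ (1↔⊤ ⊎-↔ ↔-trans *↔× (↔-refl ×-↔ ↔-trans +↔⊎ (1↔⊤ ⊎-↔ +↔⊎)))

  -- Relation 0 is the successor; relation `suc c` sends an instant to the content of register `c`.
  function : ℕ → ℕ → ℕ
  function zero    i = suc i
  function (suc c) i = proj₂ (config i) c

  -- Which relation an edge between an out-port and an in-port belongs to is decided by the labels of the ports.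
  edge : Node → Node → Bool
  edge hub       (el i)    = true
  edge (el i)    hub       = true
  edge (el i)    (out j c) = toℕ i ≡ᵇ toℕ j
  edge (el i)    (inn j c) = toℕ i ≡ᵇ toℕ j
  edge (out j c) (el i)    = toℕ i ≡ᵇ toℕ j
  edge (inn j c) (el i)    = toℕ i ≡ᵇ toℕ j
  edge (out i c) (inn j d) = toℕ j ≡ᵇ function (toℕ c) (toℕ i)
  edge (inn j d) (out i c) = toℕ j ≡ᵇ function (toℕ c) (toℕ i)
  edge _         _         = false

  hasMark : Node → Mark → Bool
  hasMark hub       hubM       = true
  hasMark (el i)    zeroM      = toℕ i ≡ᵇ 0
  hasMark (el i)    (stateM a) = a ≡ᵇ proj₁ (config (toℕ i))
  hasMark (out i c) (outM d)   = d ≡ᵇ toℕ c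
  hasMark (inn i c) (inM d)    = d ≡ᵇ toℕ c
  hasMark _         _          = false

  label : Node → ℕ → Bool
  label x p = hasMark x (decode p)

  edge-irrefl : ∀ x → edge x x ≡ false
  edge-irrefl hub       = refl
  edge-irrefl (el i)    = refl
  edge-irrefl (out i c) = refl
  edge-irrefl (inn i c) = refl

  edge-sym : ∀ x y → edge x y ≡ edge y x
  edge-sym hub       hub       = refl
  edge-sym hub       (el i)    = refl
  edge-sym hub       (out i c) = refl
  edge-sym hub       (inn i c) = refl
  edge-sym (el i)    hub       = refl
  edge-sym (el i)    (el j)    = refl
  edge-sym (el i)    (out j c) = refl
  edge-sym (el i)    (inn j c) = refl
  edge-sym (out i c) hub       = refl
  edge-sym (out i c) (el j)    = refl
  edge-sym (out i c) (out j d) = refl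
  edge-sym (out i c) (inn j d) = refl
  edge-sym (inn i c) hub       = refl
  edge-sym (inn i c) (el j)    = refl
  edge-sym (inn i c) (out j d) = refl
  edge-sym (inn i c) (inn j d) = refl

  open Inverse nodes using (to; from; strictlyInverseˡ; strictlyInverseʳ)

  graph : Graph size
  graph = record
    { E      = λ u v → edge (to u) (to v)
    ; irrefl = λ u → edge-irrefl (to u)
    ; symm   = λ u v → edge-sym (to u) (to v)
    ; lab    = λ u → label (to u)
    }

  open Relational edge label
  open Derived edge label
  open Reflection edge label graph to from strictlyInverseˡ strictlyInverseʳ (λ _ _ → refl) (λ _ _ → refl)

  mark⁺ : ∀ x m → hasMark x m ≡ true → Holds (mark m) x
  mark⁺ x m p = trans (cong (hasMark x) (decode-encode m)) p

  mark⁻ : ∀ x m → Holds (mark m) x → hasMark x m ≡ true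
  mark⁻ x m h = trans (sym (cong (hasMark x) (decode-encode m))) h

  toℕ≡⇒el≡ : ∀ {i j : Fin N} → toℕ i ≡ toℕ j → _≡_ {A = Node} (el i) (el j)
  toℕ≡⇒el≡ p = cong (λ i → el i) (toℕ-injective p)

  number : ∀ {m} → m ≤ n + T → Σ (Fin N) λ i → toℕ i ≡ m
  number m≤ = fromℕ< (s≤s m≤) , toℕ-fromℕ< (s≤s m≤)

  hub-only : ∀ x → Holds (mark hubM) x → x ≡ hub
  hub-only hub       h = refl
  hub-only (el i)    h with mark⁻ (el i) hubM h
  ... | ()
  hub-only (out i c) h with mark⁻ (out i c) hubM h
  ... | ()
  hub-only (inn i c) h with mark⁻ (inn i c) hubM h
  ... | ()

  near-hub : ∀ x → Edge x hub → Σ (Fin N) λ i → x ≡ el i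
  near-hub (el i) e = i , refl
  near-hub (out i c) ()
  near-hub (inn i c) ()

  element⁺ : ∀ i → Holds element (el i)
  element⁺ i = hub , refl , mark⁺ hub hubM refl

  element⁻ : ∀ x → Holds element x → Σ (Fin N) λ i → x ≡ el i
  element⁻ x (h , e , m) = near-hub x (subst (Edge x) (hub-only h m) e)

  out-only : ∀ x c → Holds (mark (outM c)) x → Σ (Fin N) λ i → Σ (Fin (suc K)) λ d → x ≡ out i d × c ≡ toℕ d
  out-only x c h with x | mark⁻ x (outM c) h
  ... | out i d | p = i , d , refl , ≡ᵇ-true⁻ c (toℕ d) p

  in-only : ∀ x c → Holds (mark (inM c)) x → Σ (Fin N) λ i → Σ (Fin (suc K)) λ d → x ≡ inn i d × c ≡ toℕ d
  in-only x c h with x | mark⁻ x (inM c) h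
  ... | inn i d | p = i , d , refl , ≡ᵇ-true⁻ c (toℕ d) p

  zero-only : ∀ x → Holds (mark zeroM) x → Σ (Fin N) λ i → x ≡ el i × toℕ i ≡ 0
  zero-only x h with x | mark⁻ x zeroM h
  ... | el i    | p = i , refl , ≡ᵇ-true⁻ (toℕ i) 0 p
  ... | out i c | ()
  ... | inn i c | ()

  forth⁻ : ∀ c i y → Path (forth c) (el i) y → Σ (Fin N) λ j → y ≡ el j × toℕ j ≡ function c (toℕ i)
  forth⁻ c i y path with arrow⁻ {encode (outM c)} {encode (inM c)} {el i} path
  ... | p , q , e₁ , m , e₂ , m′ , e₃ , h with out-only p c m | in-only q c m′ | element⁻ y h
  ... | i′ , d , refl , refl | j′ , d′ , refl , _ | j , refl =
    j , refl , trans (≡ᵇ-true⁻ _ _ e₃)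
      (trans (≡ᵇ-true⁻ _ _ e₂) (cong (function (toℕ d)) (sym (≡ᵇ-true⁻ (toℕ i) (toℕ i′) e₁))))

  back⁻ : ∀ c j y → Path (back c) (el j) y → Σ (Fin N) λ i → y ≡ el i × toℕ j ≡ function c (toℕ i)
  back⁻ c j y path with arrow⁻ {encode (inM c)} {encode (outM c)} {el j} path
  ... | p , q , e₁ , m , e₂ , m′ , e₃ , h with in-only p c m | out-only q c m′ | element⁻ y h
  ... | j′ , d′ , refl , _ | i′ , d , refl , refl | i , refl =
    i , refl , trans (≡ᵇ-true⁻ (toℕ j) (toℕ j′) e₁)
      (trans (≡ᵇ-true⁻ _ _ e₂) (cong (function (toℕ d)) (sym (≡ᵇ-true⁻ (toℕ i) (toℕ i′) e₃))))

  forth-is : ∀ {c i j} → c < suc K → toℕ j ≡ function c (toℕ i) → Is (forth c) (el i) (el j)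
  forth-is {c} {i} {j} c< eq =
    arrow⁺ {encode (outM c)} {encode (inM c)} {el i}
      (out i d , inn j d , ≡ᵇ-true⁺ {toℕ i} refl , mark⁺ (out i d) (outM c) (≡ᵇ-true⁺ (sym d≡c)) ,
       ≡ᵇ-true⁺ (trans eq (cong (λ c → function c (toℕ i)) (sym d≡c))) ,
       mark⁺ (inn j d) (inM c) (≡ᵇ-true⁺ (sym d≡c)) , ≡ᵇ-true⁺ {toℕ j} refl , element⁺ j) ,
    λ z p → let j′ , z≡ , eq′ = forth⁻ c i z p in trans z≡ (toℕ≡⇒el≡ (trans eq′ (sym eq)))
    where
    d = fromℕ< c<
    d≡c = toℕ-fromℕ< c<

  back-path : ∀ {c i j} → c < suc K → toℕ j ≡ function c (toℕ i) → Path (back c) (el j) (el i)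
  back-path {c} {i} {j} c< eq
    with arrow⁻ {encode (outM c)} {encode (inM c)} {el i} (proj₁ (forth-is {c} {i} {j} c< eq))
  ... | p , q , e₁ , m , e₂ , m′ , e₃ , _ =
    arrow⁺ {encode (inM c)} {encode (outM c)} {el j}
      (q , p , trans (edge-sym (el j) q) e₃ , m′ , trans (edge-sym q p) e₂ , m , trans (edge-sym p (el i)) e₁ , element⁺ i)

  register-is : ∀ {c i j} → c < K → toℕ j ≡ proj₂ (config (toℕ i)) c → Is (R c) (el i) (el j)
  register-is c<K eq = forth-is (s≤s c<K) eq

  successor-is : ∀ {i j} → toℕ j ≡ suc (toℕ i) → Is S (el i) (el j)
  successor-is eq = forth-is {0} (s≤s z≤n) eq

  origin : Node
  origin = el F.zero

  origin-zero : Holds (mark zeroM) origin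
  origin-zero = mark⁺ origin zeroM refl

  zero-origin : ∀ x → Holds (mark zeroM) x → x ≡ origin
  zero-origin x h with zero-only x h
  ... | i , refl , p = toℕ≡⇒el≡ p

  toZero-is : ∀ i → Is toZero (el i) origin
  toZero-is i =
    (hub , refl , hub , (refl , mark⁺ hub hubM refl) , origin , refl , refl , origin-zero) ,
    λ { z (_ , _ , _ , _ , .z , _ , refl , h) → zero-origin z h }

  value-is : ∀ {i j} e → RegsBelow K e → toℕ i < T →
    toℕ j ≡ eval (proj₂ (config (toℕ i))) e → Is (value e) (el i) (el j)
  value-is {i} {j} zeroE _ _ eq = subst (Is toZero (el i)) (toℕ≡⇒el≡ {F.zero} {j} (sym eq)) (toZero-is i)
  value-is {i} {j} (reg r) r<K _ eq = register-is r<K eq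
  value-is {i} {j} (sucE r) r<K i<T eq =
    let w , w≡ = number (≤-trans (run-bounded prog n (toℕ i) r) (+-monoʳ-≤ n (<⇒≤ i<T))) in
    Is-⨾ {R r} {S} {el i} (register-is {r} {i} {w} r<K w≡) (successor-is (trans eq (cong suc (sym w≡))))

  later : ∀ {i : Fin N} → toℕ i < T → Σ (Fin N) λ j → toℕ j ≡ suc (toℕ i)
  later i<T = number (≤-trans i<T (m≤n+m T n))

  updates-hold : ∀ i I → toℕ i < T → fetch prog (proj₁ (config (toℕ i))) ≡ I → Holds (updates K I) (el i)
  updates-hold i I i<T eq = ⋀⁺ K (λ c → same (S ⨾ R c) (value (after I c))) λ c c<K →
    let j , j≡ = later {i} i<T
        -- The new content is at most `n + suc i`, hence within range because `i < T`.
        v , v≡ = number (≤-trans (run-bounded prog n (suc (toℕ i)) c) (+-monoʳ-≤ n i<T))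
        below = after-below I c (subst (InstrBelow K) eq (fetch-below prog _)) c<K
    in same⁺ (S ⨾ R c) (value (after I c)) {el i}
         (Is-⨾ {S} {R c} {el i} (successor-is {i} {j} j≡)
           (register-is {c} {j} {v} c<K (trans v≡ (cong (λ t → proj₂ (config t) c) (sym j≡)))))
         (value-is {i} {v} (after I c) below i<T
           (trans v≡ (cong (λ c′ → proj₂ c′ c) (next-at prog (config (toℕ i)) eq))))

  goto-holds : ∀ i I a → toℕ i < T → fetch prog (proj₁ (config (toℕ i))) ≡ I →
    target I (proj₁ (config (toℕ i))) (proj₂ (config (toℕ i))) ≡ a → Holds (goto a) (el i)
  goto-holds i I a i<T eq tgt =
    let j , j≡ = later {i} i<T in
    el j , proj₁ (successor-is {i} {j} j≡) , mark⁺ (el j) (stateM a) (≡ᵇ-true⁺ (sym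
      (trans (cong (λ t → proj₁ (config t)) j≡) (trans (cong proj₁ (next-at prog (config (toℕ i)) eq)) tgt))))

  -- Failure is stationary, so it would persist until `T`, where the instruction is `halt`.
  not-failing : ∀ {i} → i < T → fetch prog (proj₁ (config i)) ≢ fail
  not-failing {i} i<T eq with trans (sym eq) (trans (cong (λ c → fetch prog (proj₁ c)) (sym
    (run-stationary prog (initial n) (next-at prog (config i) eq) (<⇒≤ i<T)))) halts)
  ... | ()

  halted : ∀ {i} → T ≤ i → fetch prog (proj₁ (config i)) ≡ halt
  halted T≤i = trans (cong (λ c → fetch prog (proj₁ c))
    (run-stationary prog (initial n) (next-at prog (config T) halts) T≤i)) halts

  compare-values : ∀ i r s → Holds (same (R r) (R s)) (el i) →
    proj₂ (config (toℕ i)) r ≡ proj₂ (config (toℕ i)) s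
  compare-values i r s h with same⁻ (R r) (R s) {el i} h
  ... | y , (p , _) , (q , _) with forth⁻ (suc r) i y p | forth⁻ (suc s) i y q
  ... | j , refl , eq | .j , refl , eq′ = trans (sym eq) eq′

  same-values : ∀ i r s → r < K → s < K → toℕ i < T →
    proj₂ (config (toℕ i)) r ≡ proj₂ (config (toℕ i)) s → Holds (same (R r) (R s)) (el i)
  same-values i r s r<K s<K i<T eq =
    let w , w≡ = number (≤-trans (run-bounded prog n (toℕ i) r) (+-monoʳ-≤ n (<⇒≤ i<T))) in
    same⁺ (R r) (R s) {el i} (register-is {r} {i} {w} r<K w≡) (register-is {s} {i} {w} s<K (trans w≡ eq))

  instruction-holds : ∀ i I → fetch prog (proj₁ (config (toℕ i))) ≡ I →
    Holds (instruction K (proj₁ (config (toℕ i))) I) (el i)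
  instruction-holds i I eq with toℕ i <? T
  -- From `T` on the instruction is `halt`, which demands nothing.
  instruction-holds i I eq | no i≮T rewrite trans (sym eq) (halted (≮⇒≥ i≮T)) = tt
  instruction-holds i (r ≔ e) eq | yes i<T =
    goto-holds i (r ≔ e) _ i<T eq refl , updates-hold i (r ≔ e) i<T eq
  instruction-holds i (jumpEq r s a) eq | yes i<T =
    ((λ { _ (refl , h) → goto-holds i (jumpEq r s a) a i<T eq
            (target-eq r s a pc σ (compare-values i r s h)) }) ,
     (λ { _ (refl , ¬h) → goto-holds i (jumpEq r s a) (suc pc) i<T eq
            (target-neq r s a pc σ λ p → ¬h (same-values i r s r<K s<K i<T p)) })) ,
    updates-hold i (jumpEq r s a) i<T eq
    where
    pc = proj₁ (config (toℕ i))
    σ = proj₂ (config (toℕ i))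
    below = subst (InstrBelow K) eq (fetch-below prog pc)
    r<K = proj₁ below
    s<K = proj₂ below
  instruction-holds i halt eq | yes i<T = tt
  instruction-holds i fail eq | yes i<T = ⊥-elim (not-failing i<T eq)

  input-number : Σ (Fin N) λ i → toℕ i ≡ n
  input-number = number (m≤m+n n T)

  local-holds : ∀ i → Holds (local prog) (el i)
  local-holds i =
    (hub , (inj₁ refl , mark⁺ hub hubM refl) , λ z _ h → hub-only z h) ,
    atMostOne⁺ S {el i} (λ y z p q → S-functional y z (forth⁻ 0 i y p) (forth⁻ 0 i z q)) ,
    atMostOne⁺ P {el i} (λ y z p q → S-injective y z (back⁻ 0 i y p) (back⁻ 0 i z q)) ,
    (λ { _ (refl , h) (y , p , _) → zero-first h (back⁻ 0 i y p) }) ,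
    (λ { _ (refl , h) → start (≡ᵇ-true⁻ (toℕ i) 0 (mark⁻ (el i) zeroM h)) }) ,
    ⋀⁺ (length prog) (λ a → [ test (mark (stateM a)) ] instruction K a (fetch prog a))
      λ { a _ _ (refl , h) → at-state a (≡ᵇ-true⁻ a _ (mark⁻ (el i) (stateM a) h)) }
    where
    S-functional : ∀ y z → (Σ (Fin N) λ j → y ≡ el j × toℕ j ≡ suc (toℕ i)) →
      (Σ (Fin N) λ j → z ≡ el j × toℕ j ≡ suc (toℕ i)) → z ≡ y
    S-functional _ _ (j , refl , p) (j′ , refl , q) = toℕ≡⇒el≡ (trans q (sym p))

    S-injective : ∀ y z → (Σ (Fin N) λ j → y ≡ el j × toℕ i ≡ suc (toℕ j)) →
      (Σ (Fin N) λ j → z ≡ el j × toℕ i ≡ suc (toℕ j)) → z ≡ y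
    S-injective _ _ (j , refl , p) (j′ , refl , q) = toℕ≡⇒el≡ (suc-injective (trans (sym q) p))

    zero-first : ∀ {y} → Holds (mark zeroM) (el i) → ¬ (Σ (Fin N) λ j → y ≡ el j × toℕ i ≡ suc (toℕ j))
    zero-first h (j , _ , p) = 1+n≢0 (trans (sym p) (≡ᵇ-true⁻ (toℕ i) 0 (mark⁻ (el i) zeroM h)))

    start : toℕ i ≡ 0 → Holds (mark (stateM 0) ∧f ⋀ K λ c → same (R c) (R 0)) (el i)
    start p =
      mark⁺ (el i) (stateM 0) (≡ᵇ-true⁺ (cong (λ t → proj₁ (config t)) (sym p))) ,
      ⋀⁺ K (λ c → same (R c) (R 0)) λ c c<K →
        let v , v≡ = input-number
            is : ∀ {c} → c < K → Is (R c) (el i) (el v)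
            is {c} c<K = register-is {c} {i} {v} c<K (trans v≡ (cong (λ t → proj₂ (config t) c) (sym p)))
        in same⁺ (R c) (R 0) {el i} (is c<K) (is (registers>0 prog))

    at-state : ∀ a → a ≡ proj₁ (config (toℕ i)) → Holds (instruction K a (fetch prog a)) (el i)
    at-state _ refl = instruction-holds i _ refl

  numeral-holds : ∀ m j → toℕ j ≡ m → Holds (iterate◇ P (mark zeroM) m) (el j)
  numeral-holds zero    j eq = mark⁺ (el j) zeroM (≡ᵇ-true⁺ eq)
  numeral-holds (suc m) j eq =
    let i , i≡ = number (≤-trans (n≤1+n m) (subst (_≤ n + T) eq (≤-pred (toℕ<n j)))) in
    el i , back-path {0} {i} {j} (s≤s z≤n) (trans eq (cong suc (sym i≡))) , numeral-holds m i i≡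

  satisfiable : Satisfiable (withInput input P (mark zeroM) (describe prog) n)
  satisfiable = size , graph , from hub , holds⁻ formula (from hub)
    (subst (Holds formula) (sym (strictlyInverseˡ hub))
      ((mark⁺ hub hubM refl ,
        (origin , (refl , origin-zero) , λ z _ h → zero-origin z h) ,
        λ y e → near y (near-hub y (trans (edge-sym y hub) e))) ,
       -- The origin is instant 0, at which register 0 contains `n`.
       el v , (origin , refl , origin , (refl , origin-zero) ,
               proj₁ (register-is {0} {F.zero} {v} (registers>0 prog) v≡)) ,
       numeral-holds n v v≡))
    where
    formula = withInput input P (mark zeroM) (describe prog) n
    v = proj₁ input-number
    v≡ = proj₂ input-number

    near : ∀ y → (Σ (Fin N) λ i → y ≡ el i) → Holds (local prog) y
    near _ (i , refl) = local-holds i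

halt-satisfiable : ∀ prog n {c} → prog ⊢ initial n ⟶* c → fetch prog (proj₁ c) ≡ halt →
  Satisfiable (withInput input P (mark zeroM) (describe prog) n)
halt-satisfiable prog n steps halts =
  let T , eq = ⟶*⇒run steps in
  Completeness.satisfiable prog n T (trans (cong (λ c → fetch prog (proj₁ c)) eq) halts)

-- Diagonalisation

-- Stated for arbitrary formulas: only soundness and completeness of the description enter.
diagonalisation : (ρ π : Prog) (ψ : Form) (χ : List Instr → Form) →
  (∀ prog n {c} → Satisfiable (withInput ρ π ψ (χ prog) n) → prog ⊢ initial n ⟶* c → fetch prog (proj₁ c) ≢ fail) →
  (∀ prog n {c} → prog ⊢ initial n ⟶* c → fetch prog (proj₁ c) ≡ halt → Satisfiable (withInput ρ π ψ (χ prog) n)) →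
  ¬ (Σ (PR 1) λ d → DecidesSat d)
diagonalisation ρ π ψ χ sound complete (d , decides) = unsatisfiable satisfiable
  where
  g : PR 1
  g = comp d (diagonalPR (codeP ρ) (codeP π) (code ψ) ∷ [])

  n : ℕ
  n = code (χ (program g))

  φ : Form
  φ = withInput ρ π ψ (χ (program g)) n

  g↓ : ∀ {y} → d ⟦ code φ ∷ [] ⟧↓ y → g ⟦ n ∷ [] ⟧↓ y
  g↓ D = comp↓ (diagonalPR↓ ρ π ψ (χ (program g)) ∷↓ []↓) D

  -- A model would make `d` answer 1 and the machine fail, against soundness. Unsatisfiability then
  -- makes `d` answer 0 and the machine halt, which gives a model; no case distinction on
  -- satisfiability is made.
  unsatisfiable : ¬ Satisfiable φ
  unsatisfiable sat =
    let c , steps , fails = program-rejects g (g↓ (proj₁ (decides φ) sat)) in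
    sound (program g) n sat steps fails

  satisfiable : Satisfiable φ
  satisfiable =
    let c , steps , halts = program-accepts g (g↓ (proj₂ (decides φ) unsatisfiable)) in
    complete (program g) n steps halts

theorem4p11 : ¬ (Σ (PR 1) λ d → DecidesSat d)
theorem4p11 = diagonalisation input P (mark zeroM) describe satisfiable-no-fail halt-satisfiable
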